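{- Let $G$ be the complete graph on vertex set $V$, and let $H=(V,E,w)$ be a weighted graph with $n$ vertices and a vertex of degree $d$. If $H$ $\kappa$-approximates $G$, then $$\kappa\;\ge\;1+\frac{2}{\sqrt d}-O\!\left(\frac{\sqrt d}{n}\right).$$
   Context: A weighted graph $H=(V,E,w)$ is a finite simple undirected graph with edge weights $w_e>0$; its Laplacian $L_H$ is the symmetric matrix with $x^TL_Hx=\sum_{(u,v)\in E}w_{u,v}(x_u-x_v)^2$. The complete graph $G$ has all edge weights equal to $1$. The degree of a vertex is the number of edges incident to it (not counting weights); here $n\ge 2$ and $d\geq 1$. $H$ is a $\kappa$-approximation of $G$ (or $H$ $\kappa$-approximates $G$) if $x^TL_Gx\le x^TL_Hx\le\kappa\, x^TL_Gx$ for all $x\in\mathbb{R}^V$. The $O(\cdot)$ means: there is an absolute constant $C$ (independent of $n$, $d$, $\kappa$ and $H$) such that $\kappa\ge 1+2/\sqrt d-C\sqrt d/n$. -}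

module Defs where

open import Algebra.Bundles using (CommutativeRing)
import Algebra.Properties.Semiring.Sum as SemiringSum
open import Data.Bool.Base using (Bool; true; false; if_then_else_; _∧_; not)
open import Data.Fin.Base as Fin using (Fin)
import Data.Fin.Properties as Finₚ
open import Data.Fin.Subset using (Subset; ∣_∣)
open import Data.Integer.Base as ℤ using (+_)
import Data.Integer.Properties as ℤₚ
import Data.Integer.Tactic.RingSolver as ℤ-Solver
open import Data.Nat.Base as ℕ using (ℕ; zero; suc; z≤n; s≤s)
import Data.Nat.Properties as ℕₚ
import Data.Nat.Tactic.RingSolver as ℕ-Solver
open import Data.Product using (∃; _×_; _,_; proj₁; proj₂)
open import Data.Rational.Base as ℚ using (ℚ; 0ℚ; 1ℚ; ½)
import Data.Rational.Properties as ℚₚ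
open import Data.Rational.Solver using (module +-*-Solver)
import Data.Rational.Unnormalised.Base as ℚᵘ
import Data.Rational.Unnormalised.Properties as ℚᵘₚ
open import Data.Sum.Base using (inj₁; inj₂)
open import Data.Vec.Base using (tabulate)
open import Level using (0ℓ)
open import Relation.Binary.Definitions using (tri<; tri≈; tri>)
open import Relation.Binary.PropositionalEquality using (_≡_; refl; sym; trans; cong; cong₂; subst; subst₂)
open import Relation.Nullary.Decidable using (does; dec-true; dec-false; yes; no)
open import Relation.Nullary.Negation using (contradiction)

------------------------------------------------------------------------
-- Rational numbers

module ℚ-Facts where
  absℚ : ℚ → ℚ
  absℚ = ℚ.∣_∣

  half>0 : ∀ {ε} → 0ℚ ℚ.< ε → 0ℚ ℚ.< ½ ℚ.* ε
  half>0 {ε} ε>0 = subst (ℚ._< ½ ℚ.* ε) (ℚₚ.*-zeroʳ ½) (ℚₚ.*-monoʳ-<-pos ½ ε>0)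

  half+half : ∀ ε → ½ ℚ.* ε ℚ.+ ½ ℚ.* ε ≡ ε
  half+half ε = trans (sym (ℚₚ.*-distribʳ-+ ε ½ ½)) (ℚₚ.*-identityˡ ε)

  *>0 : ∀ {p q} → 0ℚ ℚ.< p → 0ℚ ℚ.< q → 0ℚ ℚ.< p ℚ.* q
  *>0 {p} {q} p>0 q>0 =
    ℚₚ.positive⁻¹ (p ℚ.* q) {{ℚₚ.pos*pos⇒pos p {{ℚ.positive p>0}} q {{ℚ.positive q>0}}}}

  *-mono-≤₀ : ∀ {p q r s} → 0ℚ ℚ.≤ q → 0ℚ ℚ.≤ r → p ℚ.≤ q → r ℚ.≤ s → p ℚ.* r ℚ.≤ q ℚ.* s
  *-mono-≤₀ {p} {q} {r} {s} 0≤q 0≤r p≤q r≤s = ℚₚ.≤-trans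
    (ℚₚ.*-monoʳ-≤-nonNeg r {{ℚ.nonNegative 0≤r}} p≤q)
    (ℚₚ.*-monoˡ-≤-nonNeg q {{ℚ.nonNegative 0≤q}} r≤s)

  p≤∣p∣ : ∀ p → p ℚ.≤ absℚ p
  p≤∣p∣ p with ℚₚ.≤-total 0ℚ p
  ... | inj₁ 0≤p = ℚₚ.≤-reflexive (sym (ℚₚ.0≤p⇒∣p∣≡p 0≤p))
  ... | inj₂ p≤0 = ℚₚ.≤-trans p≤0 (ℚₚ.0≤∣p∣ p)

  ∣p-q∣≡∣q-p∣ : ∀ p q → absℚ (p ℚ.- q) ≡ absℚ (q ℚ.- p)
  ∣p-q∣≡∣q-p∣ p q = trans (cong absℚ (lem p q)) (ℚₚ.∣-p∣≡∣p∣ (q ℚ.- p))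
    where
    open +-*-Solver
    lem : ∀ p q → p ℚ.- q ≡ ℚ.- (q ℚ.- p)
    lem = solve 2 (λ p q → p :- q := :- (q :- p)) refl

  ∣p-p∣<ε : ∀ p {ε} → 0ℚ ℚ.< ε → absℚ (p ℚ.- p) ℚ.< ε
  ∣p-p∣<ε p {ε} ε>0 = subst (ℚ._< ε) (sym (cong absℚ (ℚₚ.+-inverseʳ p))) ε>0

  ≡⇒∣-∣<ε : ∀ {p q ε} → p ≡ q → 0ℚ ℚ.< ε → absℚ (p ℚ.- q) ℚ.< ε
  ≡⇒∣-∣<ε {p} refl = ∣p-p∣<ε p

  triangle : ∀ p q r → absℚ (p ℚ.- r) ℚ.≤ absℚ (p ℚ.- q) ℚ.+ absℚ (q ℚ.- r)
  triangle p q r = subst (ℚ._≤ absℚ (p ℚ.- q) ℚ.+ absℚ (q ℚ.- r)) (cong absℚ (lem p q r))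
      (ℚₚ.∣p+q∣≤∣p∣+∣q∣ (p ℚ.- q) (q ℚ.- r))
    where
    open +-*-Solver
    lem : ∀ p q r → (p ℚ.- q) ℚ.+ (q ℚ.- r) ≡ p ℚ.- r
    lem = solve 3 (λ p q r → (p :- q) :+ (q :- r) := p :- r) refl

  triangle-half : ∀ {p q r ε} → absℚ (p ℚ.- q) ℚ.< ½ ℚ.* ε → absℚ (q ℚ.- r) ℚ.< ½ ℚ.* ε →
                  absℚ (p ℚ.- r) ℚ.< ε
  triangle-half {p} {q} {r} {ε} pq qr = ℚₚ.≤-<-trans (triangle p q r)
    (subst (_ ℚ.<_) (half+half ε) (ℚₚ.+-mono-< pq qr))

  +-close : ∀ {p q p′ q′ ε} → absℚ (p ℚ.- p′) ℚ.< ½ ℚ.* ε → absℚ (q ℚ.- q′) ℚ.< ½ ℚ.* ε →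
            absℚ ((p ℚ.+ q) ℚ.- (p′ ℚ.+ q′)) ℚ.< ε
  +-close {p} {q} {p′} {q′} {ε} pp qq = subst (ℚ._< ε) (cong absℚ (lem p q p′ q′))
      (ℚₚ.≤-<-trans (ℚₚ.∣p+q∣≤∣p∣+∣q∣ (p ℚ.- p′) (q ℚ.- q′))
        (subst (_ ℚ.<_) (half+half ε) (ℚₚ.+-mono-< pp qq)))
    where
    open +-*-Solver
    lem : ∀ p q p′ q′ → (p ℚ.- p′) ℚ.+ (q ℚ.- q′) ≡ (p ℚ.+ q) ℚ.- (p′ ℚ.+ q′)
    lem = solve 4 (λ p q p′ q′ → (p :- p′) :+ (q :- q′) := (p :+ q) :- (p′ :+ q′)) refl

  neg-close : ∀ {p q ε} → absℚ (p ℚ.- q) ℚ.< ε → absℚ ((ℚ.- p) ℚ.- (ℚ.- q)) ℚ.< ε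
  neg-close {p} {q} {ε} pq = subst (ℚ._< ε)
      (trans (sym (ℚₚ.∣-p∣≡∣p∣ (p ℚ.- q))) (cong absℚ (ℚₚ.neg-distrib-+ p (ℚ.- q)))) pq

  inv : ∀ p → 0ℚ ℚ.< p → ℚ
  inv p p>0 = (ℚ.1/ p) {{ℚ.>-nonZero p>0}}

  inv>0 : ∀ p (p>0 : 0ℚ ℚ.< p) → 0ℚ ℚ.< inv p p>0
  inv>0 p p>0 = ℚₚ.positive⁻¹ (inv p p>0) {{ℚₚ.1/pos⇒pos p {{ℚ.positive p>0}}}}

  inv-inverse : ∀ p (p>0 : 0ℚ ℚ.< p) → p ℚ.* inv p p>0 ≡ 1ℚ
  inv-inverse p p>0 = ℚₚ.*-inverseʳ p {{ℚ.>-nonZero p>0}}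

  *-close : ∀ {p q p′ q′ B δ} → 0ℚ ℚ.< B → absℚ p ℚ.≤ B → absℚ q′ ℚ.≤ B →
            absℚ (p ℚ.- p′) ℚ.< δ → absℚ (q ℚ.- q′) ℚ.< δ →
            absℚ ((p ℚ.* q) ℚ.- (p′ ℚ.* q′)) ℚ.< B ℚ.* δ ℚ.+ B ℚ.* δ
  *-close {p} {q} {p′} {q′} {B} {δ} B>0 ∣p∣≤B ∣q′∣≤B pp qq =
      subst (ℚ._< B ℚ.* δ ℚ.+ B ℚ.* δ) (cong absℚ (lem p q p′ q′))
        (ℚₚ.≤-<-trans (ℚₚ.∣p+q∣≤∣p∣+∣q∣ (p ℚ.* (q ℚ.- q′)) (q′ ℚ.* (p ℚ.- p′)))
          (ℚₚ.+-mono-< (part p (q ℚ.- q′) ∣p∣≤B qq) (part q′ (p ℚ.- p′) ∣q′∣≤B pp)))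
    where
    open +-*-Solver
    lem : ∀ p q p′ q′ → p ℚ.* (q ℚ.- q′) ℚ.+ q′ ℚ.* (p ℚ.- p′) ≡ (p ℚ.* q) ℚ.- (p′ ℚ.* q′)
    lem = solve 4 (λ p q p′ q′ → p :* (q :- q′) :+ q′ :* (p :- p′) := (p :* q) :- (p′ :* q′)) refl
    part : ∀ a b → absℚ a ℚ.≤ B → absℚ b ℚ.< δ → absℚ (a ℚ.* b) ℚ.< B ℚ.* δ
    part a b a≤B b<δ = subst (ℚ._< B ℚ.* δ) (sym (ℚₚ.∣p*q∣≡∣p∣*∣q∣ a b))
      (ℚₚ.≤-<-trans (ℚₚ.*-monoʳ-≤-nonNeg (absℚ b) {{ℚₚ.∣-∣-nonNeg b}} a≤B)
        (ℚₚ.*-monoʳ-<-pos B {{ℚ.positive B>0}} b<δ))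

  scale : ∀ B (B>0 : 0ℚ ℚ.< B) ε → B ℚ.* (inv B B>0 ℚ.* ε) ≡ ε
  scale B B>0 ε = trans (sym (ℚₚ.*-assoc B (inv B B>0) ε))
    (trans (cong (ℚ._* ε) (inv-inverse B B>0)) (ℚₚ.*-identityˡ ε))

open ℚ-Facts

------------------------------------------------------------------------
-- Real numbers: Cauchy sequences of rationals, compared up to _≃_

Eventually : (ℕ → Set) → Set
Eventually P = ∃ λ N → ∀ n → N ℕ.≤ n → P n

eventually-map : ∀ {P Q : ℕ → Set} → (∀ n → P n → Q n) → Eventually P → Eventually Q
eventually-map f (N , p) = N , λ n N≤n → f n (p n N≤n)

eventually-zip : ∀ {P Q R : ℕ → Set} → (∀ n → P n → Q n → R n) →
                 Eventually P → Eventually Q → Eventually R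
eventually-zip f (M , p) (N , q) = M ℕ.⊔ N , λ n M⊔N≤n →
  f n (p n (ℕₚ.≤-trans (ℕₚ.m≤m⊔n M N) M⊔N≤n)) (q n (ℕₚ.≤-trans (ℕₚ.m≤n⊔m M N) M⊔N≤n))

always : ∀ {P : ℕ → Set} → (∀ n → P n) → Eventually P
always p = 0 , λ n _ → p n

Cauchy : (ℕ → ℚ) → Set
Cauchy s = ∀ ε → 0ℚ ℚ.< ε →
  ∃ λ N → ∀ m n → N ℕ.≤ m → N ℕ.≤ n → ℚ.∣ s m ℚ.- s n ∣ ℚ.< ε

record ℝ : Set where
  no-eta-equality
  constructor mkℝ
  field
    seq    : ℕ → ℚ
    cauchy : Cauchy seq

open ℝ public

infix 4 _≃_ _≤_ _<_

record _≃_ (x y : ℝ) : Set where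
  constructor mk≃
  field
    close : ∀ ε → 0ℚ ℚ.< ε → Eventually λ n → ℚ.∣ seq x n ℚ.- seq y n ∣ ℚ.< ε

-- Equivalent to the constructive ¬ (y < x).
record _≤_ (x y : ℝ) : Set where
  constructor mk≤
  field
    below : ∀ ε → 0ℚ ℚ.< ε → Eventually λ n → seq x n ℚ.≤ seq y n ℚ.+ ε

record _<_ (x y : ℝ) : Set where
  constructor mk<
  field
    gap       : ℚ
    gap>0     : 0ℚ ℚ.< gap
    separated : Eventually λ n → seq x n ℚ.+ gap ℚ.≤ seq y n

open _≃_ public
open _≤_ public
open _<_ public

eventually-bounded : ∀ x → ∃ λ B → 0ℚ ℚ.< B × Eventually λ n → ℚ.∣ seq x n ∣ ℚ.≤ B
eventually-bounded x with cauchy x 1ℚ (ℚₚ.positive⁻¹ 1ℚ)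
... | N , close = absℚ (seq x N) ℚ.+ 1ℚ
    , ℚₚ.+-mono-≤-< (ℚₚ.0≤∣p∣ (seq x N)) (ℚₚ.positive⁻¹ 1ℚ)
    , N , λ n N≤n → ℚₚ.≤-trans
        (subst (λ t → absℚ t ℚ.≤ absℚ (seq x N) ℚ.+ absℚ (seq x n ℚ.- seq x N))
          (lem (seq x N) (seq x n)) (ℚₚ.∣p+q∣≤∣p∣+∣q∣ (seq x N) (seq x n ℚ.- seq x N)))
        (ℚₚ.+-monoʳ-≤ (absℚ (seq x N)) (ℚₚ.<⇒≤ (close n N N≤n ℕₚ.≤-refl)))
  where
  open +-*-Solver
  lem : ∀ a b → a ℚ.+ (b ℚ.- a) ≡ b
  lem = solve 2 (λ a b → a :+ (b :- a) := b) refl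

common-bound : ∀ x y → ∃ λ B → 0ℚ ℚ.< B ×
  Eventually λ n → ℚ.∣ seq x n ∣ ℚ.≤ B × ℚ.∣ seq y n ∣ ℚ.≤ B
common-bound x y =
  let B , B>0 , M , p = eventually-bounded x
      C , C>0 , N , q = eventually-bounded y
  in B ℚ.+ C , ℚₚ.+-mono-< B>0 C>0 , M ℕ.⊔ N , λ n n≥ →
       ℚₚ.≤-trans (p n (ℕₚ.m⊔n≤o⇒m≤o M N n≥)) (p≤p+q B C C>0)
     , ℚₚ.≤-trans (q n (ℕₚ.m⊔n≤o⇒n≤o M N n≥)) (q≤p+q B C B>0)
  where
  p≤p+q : ∀ p q → 0ℚ ℚ.< q → p ℚ.≤ p ℚ.+ q
  p≤p+q p q q>0 = subst (ℚ._≤ p ℚ.+ q) (ℚₚ.+-identityʳ p) (ℚₚ.+-monoʳ-≤ p (ℚₚ.<⇒≤ q>0))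
  q≤p+q : ∀ p q → 0ℚ ℚ.< p → q ℚ.≤ p ℚ.+ q
  q≤p+q p q p>0 = subst (ℚ._≤ p ℚ.+ q) (ℚₚ.+-identityˡ q) (ℚₚ.+-monoˡ-≤ q (ℚₚ.<⇒≤ p>0))

infixl 6 _+_ _-_
infixl 7 _*_
infix  8 -_

constant : ℚ → ℝ
constant q .seq _ = q
constant q .cauchy ε ε>0 = 0 , λ _ _ _ _ → ∣p-p∣<ε q ε>0

0ℝ 1ℝ : ℝ
0ℝ = constant 0ℚ
1ℝ = constant 1ℚ

fromℕ : ℕ → ℝ
fromℕ n = constant (+ n ℚ./ 1)

_+_ : ℝ → ℝ → ℝ
(x + y) .seq n = seq x n ℚ.+ seq y n
(x + y) .cauchy ε ε>0 =
  let M , p = cauchy x (½ ℚ.* ε) (half>0 ε>0)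
      N , q = cauchy y (½ ℚ.* ε) (half>0 ε>0)
  in M ℕ.⊔ N , λ m n m≥ n≥ → +-close {seq x m}
       (p m n (ℕₚ.m⊔n≤o⇒m≤o M N m≥) (ℕₚ.m⊔n≤o⇒m≤o M N n≥))
       (q m n (ℕₚ.m⊔n≤o⇒n≤o M N m≥) (ℕₚ.m⊔n≤o⇒n≤o M N n≥))

-_ : ℝ → ℝ
(- x) .seq n = ℚ.- seq x n
(- x) .cauchy ε ε>0 =
  let N , p = cauchy x ε ε>0
  in N , λ m n m≥ n≥ → neg-close {seq x m} (p m n m≥ n≥)

_-_ : ℝ → ℝ → ℝ
x - y = x + (- y)

_*_ : ℝ → ℝ → ℝ
(x * y) .seq n = seq x n ℚ.* seq y n
(x * y) .cauchy ε ε>0 =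
  let B , B>0 , K , b = common-bound x y
      δ = inv B B>0 ℚ.* (½ ℚ.* ε)
      δ>0 = *>0 (inv>0 B B>0) (half>0 ε>0)
      M , p = cauchy x δ δ>0
      N , q = cauchy y δ δ>0
      Bδ+Bδ≡ε = trans (cong₂ ℚ._+_ (scale B B>0 (½ ℚ.* ε)) (scale B B>0 (½ ℚ.* ε))) (half+half ε)
  in K ℕ.⊔ (M ℕ.⊔ N) , λ m n m≥ n≥ →
       let m≥′ = ℕₚ.m⊔n≤o⇒n≤o K (M ℕ.⊔ N) m≥
           n≥′ = ℕₚ.m⊔n≤o⇒n≤o K (M ℕ.⊔ N) n≥
       in subst (_ ℚ.<_) Bδ+Bδ≡ε (*-close {seq x m} {seq y m} B>0
            (proj₁ (b m (ℕₚ.m⊔n≤o⇒m≤o K _ m≥)))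
            (proj₂ (b n (ℕₚ.m⊔n≤o⇒m≤o K _ n≥)))
            (p m n (ℕₚ.m⊔n≤o⇒m≤o M N m≥′) (ℕₚ.m⊔n≤o⇒m≤o M N n≥′))
            (q m n (ℕₚ.m⊔n≤o⇒n≤o M N m≥′) (ℕₚ.m⊔n≤o⇒n≤o M N n≥′)))

≃-pointwise : ∀ {x y} → (∀ n → seq x n ≡ seq y n) → x ≃ y
≃-pointwise eq = mk≃ λ ε ε>0 → always λ n → ≡⇒∣-∣<ε (eq n) ε>0

≃-refl : ∀ {x} → x ≃ x
≃-refl = ≃-pointwise λ _ → refl

≃-sym : ∀ {x y} → x ≃ y → y ≃ x
≃-sym {x} {y} x≃y = mk≃ λ ε ε>0 →
  eventually-map (λ n → subst (ℚ._< ε) (∣p-q∣≡∣q-p∣ (seq x n) (seq y n))) (close x≃y ε ε>0)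

≃-trans : ∀ {x y z} → x ≃ y → y ≃ z → x ≃ z
≃-trans {x} {y} {z} x≃y y≃z = mk≃ λ ε ε>0 →
  eventually-zip (λ n → triangle-half {seq x n} {seq y n} {seq z n})
    (close x≃y _ (half>0 ε>0)) (close y≃z _ (half>0 ε>0))

+-cong : ∀ {x y u v} → x ≃ y → u ≃ v → x + u ≃ y + v
+-cong {x} x≃y u≃v = mk≃ λ ε ε>0 →
  eventually-zip (λ n → +-close {seq x n}) (close x≃y _ (half>0 ε>0)) (close u≃v _ (half>0 ε>0))

-‿cong : ∀ {x y} → x ≃ y → - x ≃ - y
-‿cong {x} x≃y = mk≃ λ ε ε>0 → eventually-map (λ n → neg-close {seq x n}) (close x≃y ε ε>0)

*-cong : ∀ {x y u v} → x ≃ y → u ≃ v → x * u ≃ y * v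
*-cong {x} {y} {u} {v} x≃y u≃v = mk≃ λ ε ε>0 →
  let B , B>0 , b = common-bound x v
      δ = inv B B>0 ℚ.* (½ ℚ.* ε)
      δ>0 = *>0 (inv>0 B B>0) (half>0 ε>0)
      Bδ+Bδ≡ε = trans (cong₂ ℚ._+_ (scale B B>0 (½ ℚ.* ε)) (scale B B>0 (½ ℚ.* ε))) (half+half ε)
  in eventually-zip (λ n bₙ (p , q) → subst (_ ℚ.<_) Bδ+Bδ≡ε
       (*-close {seq x n} {seq u n} B>0 (proj₁ bₙ) (proj₂ bₙ) p q))
       b (eventually-zip (λ n → _,_) (close x≃y δ δ>0) (close u≃v δ δ>0))

ℝ-commutativeRing : CommutativeRing 0ℓ 0ℓ
ℝ-commutativeRing = record
  { Carrier = ℝ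
  ; _≈_ = _≃_
  ; _+_ = _+_
  ; _*_ = _*_
  ; -_ = -_
  ; 0# = 0ℝ
  ; 1# = 1ℝ
  ; isCommutativeRing = record
    { isRing = record
      { +-isAbelianGroup = record
        { isGroup = record
          { isMonoid = record
            { isSemigroup = record
              { isMagma = record
                { isEquivalence = record { refl = ≃-refl ; sym = ≃-sym ; trans = ≃-trans }
                ; ∙-cong = +-cong
                }
              ; assoc = λ x y z → ≃-pointwise
                  λ n → ℚₚ.+-assoc (seq x n) (seq y n) (seq z n)
              }
            ; identity = (λ x → ≃-pointwise λ n → ℚₚ.+-identityˡ (seq x n))
                       , (λ x → ≃-pointwise λ n → ℚₚ.+-identityʳ (seq x n))
            }
          ; inverse = (λ x → ≃-pointwise λ n → ℚₚ.+-inverseˡ (seq x n))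
                    , (λ x → ≃-pointwise λ n → ℚₚ.+-inverseʳ (seq x n))
          ; ⁻¹-cong = -‿cong
          }
        ; comm = λ x y → ≃-pointwise λ n → ℚₚ.+-comm (seq x n) (seq y n)
        }
      ; *-cong = *-cong
      ; *-assoc = λ x y z → ≃-pointwise
          λ n → ℚₚ.*-assoc (seq x n) (seq y n) (seq z n)
      ; *-identity = (λ x → ≃-pointwise λ n → ℚₚ.*-identityˡ (seq x n))
                   , (λ x → ≃-pointwise λ n → ℚₚ.*-identityʳ (seq x n))
      ; distrib = (λ x y z → ≃-pointwise
                     λ n → ℚₚ.*-distribˡ-+ (seq x n) (seq y n) (seq z n))
                , (λ x y z → ≃-pointwise
                     λ n → ℚₚ.*-distribʳ-+ (seq x n) (seq y n) (seq z n))
      }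
    ; *-comm = λ x y → ≃-pointwise λ n → ℚₚ.*-comm (seq x n) (seq y n)
    }
  }

------------------------------------------------------------------------
-- Division by a positive real

-- Junk value 0 at arguments ≤ 0.
recip : ℚ → ℚ
recip q with 0ℚ ℚₚ.<? q
... | yes q>0 = inv q q>0
... | no  _   = 0ℚ

recip-inverse : ∀ {q} → 0ℚ ℚ.< q → q ℚ.* recip q ≡ 1ℚ
recip-inverse {q} q>0 with 0ℚ ℚₚ.<? q
... | yes p = inv-inverse q p
... | no ¬p = contradiction q>0 ¬p

recip>0 : ∀ {q} → 0ℚ ℚ.< q → 0ℚ ℚ.< recip q
recip>0 {q} q>0 with 0ℚ ℚₚ.<? q
... | yes p = inv>0 q p
... | no ¬p = contradiction q>0 ¬p

recip-close : ∀ {a b δ η} → 0ℚ ℚ.< δ → δ ℚ.≤ a → δ ℚ.≤ b → ℚ.∣ a ℚ.- b ∣ ℚ.< δ ℚ.* (δ ℚ.* η) →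
              ℚ.∣ recip a ℚ.- recip b ∣ ℚ.< η
recip-close {a} {b} {δ} {η} δ>0 δ≤a δ≤b ab =
  ℚₚ.*-cancelˡ-<-nonNeg (a ℚ.* b) {{ℚₚ.pos⇒nonNeg (a ℚ.* b) {{ℚ.positive ab>0}}}}
    (ℚₚ.<-≤-trans (subst (ℚ._< δ ℚ.* (δ ℚ.* η)) step ab) bound)
  where
  open +-*-Solver
  a>0 = ℚₚ.<-≤-trans δ>0 δ≤a
  b>0 = ℚₚ.<-≤-trans δ>0 δ≤b
  ab>0 = *>0 a>0 b>0
  η>0 : 0ℚ ℚ.< η
  η>0 = ℚₚ.*-cancelˡ-<-nonNeg (δ ℚ.* δ)
    {{ℚₚ.pos⇒nonNeg (δ ℚ.* δ) {{ℚ.positive (*>0 δ>0 δ>0)}}}}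
    (subst₂ ℚ._<_ (sym (ℚₚ.*-zeroʳ (δ ℚ.* δ))) (sym (ℚₚ.*-assoc δ δ η))
      (ℚₚ.≤-<-trans (ℚₚ.0≤∣p∣ (a ℚ.- b)) ab))
  bound : δ ℚ.* (δ ℚ.* η) ℚ.≤ (a ℚ.* b) ℚ.* η
  bound = subst (ℚ._≤ (a ℚ.* b) ℚ.* η) (ℚₚ.*-assoc δ δ η)
    (ℚₚ.*-monoʳ-≤-nonNeg η {{ℚ.nonNegative (ℚₚ.<⇒≤ η>0)}}
      (*-mono-≤₀ (ℚₚ.<⇒≤ a>0) (ℚₚ.<⇒≤ δ>0) δ≤a δ≤b))
  expand : ∀ a b r s → (a ℚ.* b) ℚ.* (r ℚ.- s) ≡ b ℚ.* (a ℚ.* r) ℚ.- a ℚ.* (b ℚ.* s)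
  expand = solve 4 (λ a b r s → (a :* b) :* (r :- s) := b :* (a :* r) :- a :* (b :* s)) refl
  identity : (a ℚ.* b) ℚ.* (recip a ℚ.- recip b) ≡ b ℚ.- a
  identity = trans (expand a b (recip a) (recip b))
    (cong₂ ℚ._-_ (trans (cong (b ℚ.*_) (recip-inverse a>0)) (ℚₚ.*-identityʳ b))
                 (trans (cong (a ℚ.*_) (recip-inverse b>0)) (ℚₚ.*-identityʳ a)))
  step : ℚ.∣ a ℚ.- b ∣ ≡ (a ℚ.* b) ℚ.* ℚ.∣ recip a ℚ.- recip b ∣
  step = trans (∣p-q∣≡∣q-p∣ a b) (trans (cong absℚ (sym identity))
    (trans (ℚₚ.∣p*q∣≡∣p∣*∣q∣ (a ℚ.* b) (recip a ℚ.- recip b))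
           (cong (ℚ._* absℚ (recip a ℚ.- recip b)) (ℚₚ.0≤p⇒∣p∣≡p (ℚₚ.<⇒≤ ab>0)))))

module _ (x : ℝ) (x>0 : 0ℝ < x) where

  eventually-≥ : Eventually λ n → gap x>0 ℚ.≤ seq x n
  eventually-≥ = eventually-map (λ n → subst (ℚ._≤ seq x n) (ℚₚ.+-identityˡ (gap x>0))) (separated x>0)

  1/ : ℝ
  1/ .seq n = recip (seq x n)
  1/ .cauchy ε ε>0 =
    let δ = gap x>0
        δ>0 = gap>0 x>0
        M , b = eventually-≥
        N , p = cauchy x (δ ℚ.* (δ ℚ.* ε)) (*>0 δ>0 (*>0 δ>0 ε>0))
    in M ℕ.⊔ N , λ m n m≥ n≥ → recip-close {seq x m} {seq x n} δ>0
         (b m (ℕₚ.m⊔n≤o⇒m≤o M N m≥)) (b n (ℕₚ.m⊔n≤o⇒m≤o M N n≥))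
         (p m n (ℕₚ.m⊔n≤o⇒n≤o M N m≥) (ℕₚ.m⊔n≤o⇒n≤o M N n≥))

  1/-inverseʳ : x * 1/ ≃ 1ℝ
  1/-inverseʳ = mk≃ λ ε ε>0 → eventually-map
    (λ n b → ≡⇒∣-∣<ε (recip-inverse (ℚₚ.<-≤-trans (gap>0 x>0) b)) ε>0) eventually-≥

infixl 7 _/_⟨_⟩

_/_⟨_⟩ : (x y : ℝ) → 0ℝ < y → ℝ
x / y ⟨ y>0 ⟩ = x * 1/ y y>0

fromℕ-pos : ∀ {n} → 1 ℕ.≤ n → 0ℝ < fromℕ n
fromℕ-pos {suc n} _ = mk< q (ℚₚ.positive⁻¹ q {{pos}}) (always λ _ → ℚₚ.≤-reflexive (ℚₚ.+-identityˡ q))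
  where
  q = + suc n ℚ./ 1
  pos = ℚₚ.normalize-pos (suc n) 1

------------------------------------------------------------------------
-- Square root of a natural number

⌊√_⌋ : ℕ → ℕ
⌊√ zero ⌋ = 0
⌊√ suc n ⌋ with suc ⌊√ n ⌋ ℕ.* suc ⌊√ n ⌋ ℕₚ.≤? suc n
... | yes _ = suc ⌊√ n ⌋
... | no  _ = ⌊√ n ⌋

⌊√⌋-lower : ∀ n → ⌊√ n ⌋ ℕ.* ⌊√ n ⌋ ℕ.≤ n
⌊√⌋-lower zero = z≤n
⌊√⌋-lower (suc n) with suc ⌊√ n ⌋ ℕ.* suc ⌊√ n ⌋ ℕₚ.≤? suc n
... | yes p = p
... | no  _ = ℕₚ.m≤n⇒m≤1+n (⌊√⌋-lower n)

⌊√⌋-upper : ∀ n → n ℕ.< suc ⌊√ n ⌋ ℕ.* suc ⌊√ n ⌋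
⌊√⌋-upper zero = s≤s z≤n
⌊√⌋-upper (suc n) with suc ⌊√ n ⌋ ℕ.* suc ⌊√ n ⌋ ℕₚ.≤? suc n
... | yes _ = ℕₚ.≤-<-trans (⌊√⌋-upper n) (ℕₚ.*-mono-< (ℕₚ.n<1+n (suc ⌊√ n ⌋)) (ℕₚ.n<1+n (suc ⌊√ n ⌋)))
... | no ¬p = ℕₚ.≰⇒> ¬p

-- √-approx d k / (k + 1) is the largest multiple of 1 / (k + 1) that is at most √d.
√-approx : ℕ → ℕ → ℕ
√-approx d k = ⌊√ d ℕ.* (suc k ℕ.* suc k) ⌋

sq-cancel-< : ∀ {m n} → m ℕ.* m ℕ.< n ℕ.* n → m ℕ.< n
sq-cancel-< m²<n² = ℕₚ.≰⇒> λ n≤m → ℕₚ.<⇒≱ m²<n² (ℕₚ.*-mono-≤ n≤m n≤m)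

sq-cancel-≤ : ∀ {m n} → m ℕ.* m ℕ.≤ n ℕ.* n → m ℕ.≤ n
sq-cancel-≤ m²≤n² = ℕₚ.≮⇒≥ λ n<m → ℕₚ.≤⇒≯ m²≤n² (ℕₚ.*-mono-< n<m n<m)

√-approx-cross : ∀ d k m → √-approx d k ℕ.* suc m ℕ.≤ suc (√-approx d m) ℕ.* suc k
√-approx-cross d k m = ℕₚ.<⇒≤ (sq-cancel-< (begin-strict
  (r ℕ.* M) ℕ.* (r ℕ.* M)         ≡⟨ swap r M ⟩
  (r ℕ.* r) ℕ.* (M ℕ.* M)         ≤⟨ ℕₚ.*-monoˡ-≤ (M ℕ.* M) (⌊√⌋-lower (d ℕ.* (K ℕ.* K))) ⟩
  (d ℕ.* (K ℕ.* K)) ℕ.* (M ℕ.* M) ≡⟨ swap′ d (K ℕ.* K) (M ℕ.* M) ⟩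
  (d ℕ.* (M ℕ.* M)) ℕ.* (K ℕ.* K) <⟨ ℕₚ.*-monoˡ-< (K ℕ.* K) (⌊√⌋-upper (d ℕ.* (M ℕ.* M))) ⟩
  (s ℕ.* s) ℕ.* (K ℕ.* K)         ≡⟨ swap s K ⟨
  (s ℕ.* K) ℕ.* (s ℕ.* K)         ∎))
  where
  open ℕₚ.≤-Reasoning
  r = √-approx d k
  s = suc (√-approx d m)
  K = suc k
  M = suc m
  swap : ∀ a b → (a ℕ.* b) ℕ.* (a ℕ.* b) ≡ (a ℕ.* a) ℕ.* (b ℕ.* b)
  swap = ℕ-Solver.solve-∀
  swap′ : ∀ a b c → (a ℕ.* b) ℕ.* c ≡ (a ℕ.* c) ℕ.* b
  swap′ = ℕ-Solver.solve-∀

√-approx-≤ : ∀ d k → √-approx d k ℕ.≤ d ℕ.* suc k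
√-approx-≤ zero k = ℕₚ.≤-reflexive refl
√-approx-≤ d@(suc _) k = sq-cancel-≤ (begin
  r ℕ.* r                         ≤⟨ ⌊√⌋-lower (d ℕ.* (K ℕ.* K)) ⟩
  d ℕ.* (K ℕ.* K)                 ≤⟨ ℕₚ.m≤n*m _ d ⟩
  d ℕ.* (d ℕ.* (K ℕ.* K))         ≡⟨ rearrange d K ⟩
  (d ℕ.* K) ℕ.* (d ℕ.* K)         ∎)
  where
  open ℕₚ.≤-Reasoning
  r = √-approx d k
  K = suc k
  rearrange : ∀ a b → a ℕ.* (a ℕ.* (b ℕ.* b)) ≡ (a ℕ.* b) ℕ.* (a ℕ.* b)
  rearrange = ℕ-Solver.solve-∀

√-approx-sq : ∀ d k → d ℕ.* (suc k ℕ.* suc k) ℕ.≤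
                      √-approx d k ℕ.* √-approx d k ℕ.+ 2 ℕ.* d ℕ.* suc k
√-approx-sq d k = begin
  d ℕ.* (K ℕ.* K)                 ≤⟨ ℕₚ.m<1+n⇒m≤n (subst (d ℕ.* (K ℕ.* K) ℕ.<_) (expand r) (⌊√⌋-upper (d ℕ.* (K ℕ.* K)))) ⟩
  r ℕ.* r ℕ.+ 2 ℕ.* r             ≤⟨ ℕₚ.+-monoʳ-≤ (r ℕ.* r) (ℕₚ.*-monoʳ-≤ 2 (√-approx-≤ d k)) ⟩
  r ℕ.* r ℕ.+ 2 ℕ.* (d ℕ.* K)     ≡⟨ cong (r ℕ.* r ℕ.+_) (sym (ℕₚ.*-assoc 2 d K)) ⟩
  r ℕ.* r ℕ.+ 2 ℕ.* d ℕ.* K       ∎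
  where
  open ℕₚ.≤-Reasoning
  r = √-approx d k
  K = suc k
  expand : ∀ a → (1 ℕ.+ a) ℕ.* (1 ℕ.+ a) ≡ 1 ℕ.+ (a ℕ.* a ℕ.+ 2 ℕ.* a)
  expand = ℕ-Solver.solve-∀

√-approx-≥ : ∀ d k → 1 ℕ.≤ d → suc k ℕ.≤ √-approx d k
√-approx-≥ d k 1≤d = ℕₚ.m<1+n⇒m≤n (sq-cancel-< (ℕₚ.≤-<-trans
  (ℕₚ.m≤n*m (suc k ℕ.* suc k) d {{ℕ.>-nonZero 1≤d}}) (⌊√⌋-upper (d ℕ.* (suc k ℕ.* suc k)))))

frac : ℕ → ℕ → ℚ
frac a k = + a ℚ./ suc k

frac-toℚᵘ : ∀ a k → ℚ.toℚᵘ (frac a k) ℚᵘ.≃ ℚᵘ.mkℚᵘ (+ a) k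
frac-toℚᵘ a k = ℚₚ.toℚᵘ-fromℚᵘ (ℚᵘ.mkℚᵘ (+ a) k)

≤-via-ℚᵘ : ∀ {p q u v} → ℚ.toℚᵘ p ℚᵘ.≃ u → ℚ.toℚᵘ q ℚᵘ.≃ v → u ℚᵘ.≤ v → p ℚ.≤ q
≤-via-ℚᵘ p≃u q≃v u≤v = ℚₚ.toℚᵘ-cancel-≤
  (ℚᵘₚ.≤-respˡ-≃ (ℚᵘₚ.≃-sym p≃u) (ℚᵘₚ.≤-respʳ-≃ (ℚᵘₚ.≃-sym q≃v) u≤v))

frac-≤ : ∀ {a k b m} → a ℕ.* suc m ℕ.≤ b ℕ.* suc k → frac a k ℚ.≤ frac b m
frac-≤ {a} {k} {b} {m} le = ≤-via-ℚᵘ (frac-toℚᵘ a k) (frac-toℚᵘ b m)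
  (ℚᵘ.*≤* (subst₂ ℤ._≤_ (ℤₚ.pos-* a (suc m)) (ℤₚ.pos-* b (suc k)) (ℤ.+≤+ le)))

frac-suc : ∀ a k → frac (suc a) k ℚ.≤ frac a k ℚ.+ frac 1 k
frac-suc a k = ≤-via-ℚᵘ (frac-toℚᵘ (suc a) k)
  (ℚᵘₚ.≃-trans (ℚₚ.toℚᵘ-homo-+ (frac a k) (frac 1 k)) (ℚᵘₚ.+-cong (frac-toℚᵘ a k) (frac-toℚᵘ 1 k)))
  (ℚᵘ.*≤* (ℤₚ.≤-reflexive (lem (+ a) (+ suc k))))
  where
  lem : ∀ x y → (+ 1 ℤ.+ x) ℤ.* (y ℤ.* y) ≡ (x ℤ.* y ℤ.+ + 1 ℤ.* y) ℤ.* y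
  lem = ℤ-Solver.solve-∀

frac-eventually-small : ∀ c ε → 0ℚ ℚ.< ε → Eventually λ n → frac c n ℚ.< ε
frac-eventually-small c ε@(ℚ.mkℚ ℤ.+[1+ a ] e _) ε>0 = suc c ℕ.* suc e , λ n n≥ →
  ℚₚ.toℚᵘ-cancel-< (ℚᵘₚ.<-respˡ-≃ (ℚᵘₚ.≃-sym (frac-toℚᵘ c n))
    (ℚᵘ.*<* (subst₂ ℤ._<_ (ℤₚ.pos-* c (suc e)) (ℤₚ.pos-* (suc a) (suc n))
      (ℤ.+<+ (ℕₚ.<-≤-trans (ℕₚ.*-monoˡ-< (suc e) (ℕₚ.n<1+n c))
        (ℕₚ.≤-trans n≥ (ℕₚ.≤-trans (ℕₚ.n≤1+n n) (ℕₚ.m≤n*m (suc n) (suc a)))))))))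
frac-eventually-small c (ℚ.mkℚ (+ 0) _ _) (ℚ.*<* (ℤ.+<+ ()))
frac-eventually-small c (ℚ.mkℚ ℤ.-[1+ _ ] _ _) (ℚ.*<* ())

∣-∣<-intro : ∀ {p q e f ε} → p ℚ.≤ q ℚ.+ e → q ℚ.≤ p ℚ.+ f → e ℚ.< ε → f ℚ.< ε →
             ℚ.∣ p ℚ.- q ∣ ℚ.< ε
∣-∣<-intro {p} {q} {e} {f} {ε} p≤q+e q≤p+f e<ε f<ε with ℚₚ.∣p∣≡p∨∣p∣≡-p (p ℚ.- q)
... | inj₁ eq = subst (ℚ._< ε) (sym eq) (ℚₚ.≤-<-trans (move p≤q+e) e<ε)
  where
  open +-*-Solver
  lem : ∀ q e → (q ℚ.+ e) ℚ.- q ≡ e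
  lem = solve 2 (λ q e → (q :+ e) :- q := e) refl
  move : p ℚ.≤ q ℚ.+ e → p ℚ.- q ℚ.≤ e
  move le = subst (p ℚ.- q ℚ.≤_) (lem q e) (ℚₚ.+-monoˡ-≤ (ℚ.- q) le)
... | inj₂ eq = subst (ℚ._< ε) (sym eq) (ℚₚ.≤-<-trans (move q≤p+f) f<ε)
  where
  open +-*-Solver
  lem₁ : ∀ p q → q ℚ.- p ≡ ℚ.- (p ℚ.- q)
  lem₁ = solve 2 (λ p q → q :- p := :- (p :- q)) refl
  lem₂ : ∀ p f → (p ℚ.+ f) ℚ.- p ≡ f
  lem₂ = solve 2 (λ p f → (p :+ f) :- p := f) refl
  move : q ℚ.≤ p ℚ.+ f → ℚ.- (p ℚ.- q) ℚ.≤ f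
  move le = subst₂ ℚ._≤_ (lem₁ p q) (lem₂ p f) (ℚₚ.+-monoˡ-≤ (ℚ.- p) le)

√ : ℕ → ℝ
√ d .seq k = frac (√-approx d k) k
√ d .cauchy ε ε>0 =
  let N , small = frac-eventually-small 1 ε ε>0
  in N , λ m n m≥ n≥ → ∣-∣<-intro {frac (√-approx d m) m} {frac (√-approx d n) n}
       (cross m n) (cross n m) (small n n≥) (small m m≥)
  where
  cross : ∀ m n → frac (√-approx d m) m ℚ.≤ frac (√-approx d n) n ℚ.+ frac 1 n
  cross m n = ℚₚ.≤-trans (frac-≤ {√-approx d m} {m} {suc (√-approx d n)} {n} (√-approx-cross d m n))
                         (frac-suc (√-approx d n) n)

√-nonNegative : ∀ d → 0ℝ ≤ √ d
√-nonNegative d = mk≤ λ ε ε>0 → always λ k → ℚₚ.≤-trans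
  (ℚₚ.nonNegative⁻¹ (seq (√ d) k) {{ℚₚ.normalize-nonNeg (√-approx d k) (suc k)}})
  (subst (ℚ._≤ seq (√ d) k ℚ.+ ε) (ℚₚ.+-identityʳ (seq (√ d) k)) (ℚₚ.+-monoʳ-≤ (seq (√ d) k) (ℚₚ.<⇒≤ ε>0)))

√-pos : ∀ {d} → 1 ℕ.≤ d → 0ℝ < √ d
√-pos {d} 1≤d = mk< 1ℚ (ℚₚ.positive⁻¹ 1ℚ) (always λ k →
  subst (ℚ._≤ seq (√ d) k) (sym (ℚₚ.+-identityˡ 1ℚ))
    (frac-≤ {1} {0} {√-approx d k} {k} (subst₂ ℕ._≤_ (sym (ℕₚ.*-identityˡ (suc k)))
      (sym (ℕₚ.*-identityʳ (√-approx d k))) (√-approx-≥ d k 1≤d))))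

√-square : ∀ d → √ d * √ d ≃ fromℕ d
√-square d = mk≃ λ ε ε>0 → eventually-map (within ε ε>0) (frac-eventually-small (2 ℕ.* d) ε ε>0)
  where
  upper : ∀ k → seq (√ d) k ℚ.* seq (√ d) k ℚ.≤ frac d 0
  upper k = ≤-via-ℚᵘ
    (ℚᵘₚ.≃-trans (ℚₚ.toℚᵘ-homo-* (seq (√ d) k) (seq (√ d) k))
      (ℚᵘₚ.*-cong (frac-toℚᵘ r k) (frac-toℚᵘ r k)))
    (frac-toℚᵘ d 0)
    (ℚᵘ.*≤* (subst₂ ℤ._≤_
      (trans (ℤₚ.pos-* (r ℕ.* r) 1) (cong (ℤ._* + 1) (ℤₚ.pos-* r r)))
      (ℤₚ.pos-* d (suc k ℕ.* suc k))
      (ℤ.+≤+ (subst (ℕ._≤ d ℕ.* (suc k ℕ.* suc k)) (sym (ℕₚ.*-identityʳ (r ℕ.* r)))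
        (⌊√⌋-lower (d ℕ.* (suc k ℕ.* suc k)))))))
    where r = √-approx d k
  lower : ∀ k → frac d 0 ℚ.≤ seq (√ d) k ℚ.* seq (√ d) k ℚ.+ frac (2 ℕ.* d) k
  lower k = ≤-via-ℚᵘ (frac-toℚᵘ d 0)
    (ℚᵘₚ.≃-trans (ℚₚ.toℚᵘ-homo-+ (a ℚ.* a) (frac (2 ℕ.* d) k))
      (ℚᵘₚ.+-cong (ℚᵘₚ.≃-trans (ℚₚ.toℚᵘ-homo-* a a) (ℚᵘₚ.*-cong (frac-toℚᵘ r k) (frac-toℚᵘ r k)))
        (frac-toℚᵘ (2 ℕ.* d) k)))
    (ℚᵘ.*≤* (subst₂ ℤ._≤_ (ℤₚ.pos-* d (K ℕ.* K ℕ.* K)) rhs (ℤ.+≤+ (begin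
      d ℕ.* (K ℕ.* K ℕ.* K)                                  ≡⟨ ℕₚ.*-assoc d (K ℕ.* K) K ⟨
      d ℕ.* (K ℕ.* K) ℕ.* K                                  ≤⟨ ℕₚ.*-monoˡ-≤ K (√-approx-sq d k) ⟩
      (r ℕ.* r ℕ.+ 2 ℕ.* d ℕ.* K) ℕ.* K                      ≡⟨ rearrange (r ℕ.* r) (2 ℕ.* d) K ⟩
      (r ℕ.* r ℕ.* K ℕ.+ 2 ℕ.* d ℕ.* (K ℕ.* K)) ℕ.* 1        ∎))))
    where
    open ℕₚ.≤-Reasoning
    r = √-approx d k
    a = seq (√ d) k
    K = suc k
    rearrange : ∀ x y z → (x ℕ.+ y ℕ.* z) ℕ.* z ≡ (x ℕ.* z ℕ.+ y ℕ.* (z ℕ.* z)) ℕ.* 1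
    rearrange = ℕ-Solver.solve-∀
    rhs : + ((r ℕ.* r ℕ.* K ℕ.+ 2 ℕ.* d ℕ.* (K ℕ.* K)) ℕ.* 1) ≡
          (+ r ℤ.* + r ℤ.* + K ℤ.+ + (2 ℕ.* d) ℤ.* + (K ℕ.* K)) ℤ.* + 1
    rhs = trans (ℤₚ.pos-* (r ℕ.* r ℕ.* K ℕ.+ 2 ℕ.* d ℕ.* (K ℕ.* K)) 1) (cong (ℤ._* + 1)
      (trans (ℤₚ.pos-+ (r ℕ.* r ℕ.* K) (2 ℕ.* d ℕ.* (K ℕ.* K)))
      (cong₂ ℤ._+_ (trans (ℤₚ.pos-* (r ℕ.* r) K) (cong (ℤ._* + K) (ℤₚ.pos-* r r)))
                   (ℤₚ.pos-* (2 ℕ.* d) (K ℕ.* K)))))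
  within : ∀ ε → 0ℚ ℚ.< ε → ∀ k → frac (2 ℕ.* d) k ℚ.< ε →
           absℚ (seq (√ d) k ℚ.* seq (√ d) k ℚ.- frac d 0) ℚ.< ε
  within ε ε>0 k small = ∣-∣<-intro {seq (√ d) k ℚ.* seq (√ d) k} {frac d 0}
    (subst (seq (√ d) k ℚ.* seq (√ d) k ℚ.≤_) (sym (ℚₚ.+-identityʳ (frac d 0))) (upper k))
    (lower k) ε>0 small

------------------------------------------------------------------------
-- Vectors, matrices and quadratic forms

open CommutativeRing ℝ-commutativeRing using (setoid; semiring)
  renaming (+-identityˡ to +ℝ-identityˡ; +-identityʳ to +ℝ-identityʳ)
open SemiringSum semiring using (sum-syntax; sum-cong-≋; ∑-distrib-+; ∑-comm; *-distribˡ-sum; *-distribʳ-sum; sum-replicate-zero)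

Vector : ℕ → Set
Vector n = Fin n → ℝ

Matrix : ℕ → Set
Matrix n = Fin n → Fin n → ℝ

infix 8 _ᵀ_·_

_ᵀ_·_ : ∀ {n} → Vector n → Matrix n → Vector n → ℝ
_ᵀ_·_ {n} x M y = ∑[ u < n ] ∑[ v < n ] (x u * M u v * y v)

∑-cong : ∀ {n} {f g : Fin n → ℝ} → (∀ i → f i ≃ g i) → ∑[ i < n ] f i ≃ ∑[ i < n ] g i
∑-cong = sum-cong-≋

∑-zero : ∀ n → ∑[ i < n ] 0ℝ ≃ 0ℝ
∑-zero = sum-replicate-zero

∑-δ : ∀ {n} (u : Fin n) (f : Fin n → ℝ) → ∑[ v < n ] (if does (u Finₚ.≟ v) then f v else 0ℝ) ≃ f u
∑-δ {suc n} Fin.zero f = ≃-trans (+-cong ≃-refl (∑-zero n)) (+ℝ-identityʳ (f Fin.zero))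
∑-δ {suc n} (Fin.suc u) f = ≃-trans
  (+ℝ-identityˡ (∑[ v < n ] (if does (u Finₚ.≟ v) then f (Fin.suc v) else 0ℝ)))
  (∑-δ u (λ v → f (Fin.suc v)))

------------------------------------------------------------------------
-- Weighted graphs

-- E is the set of pairs with adjacent u v ≡ true; the value of weight u v is
-- irrelevant when u and v are not adjacent.
record WeightedGraph (n : ℕ) : Set where
  field
    adjacent    : Fin n → Fin n → Bool
    adj-sym     : ∀ u v → adjacent u v ≡ adjacent v u
    adj-irrefl  : ∀ v → adjacent v v ≡ false
    weight      : Fin n → Fin n → ℝ
    weight-sym  : ∀ u v → adjacent u v ≡ true → weight u v ≃ weight v u
    weight-pos  : ∀ u v → adjacent u v ≡ true → 0ℝ < weight u v

  neighbours : Fin n → Subset n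
  neighbours v = tabulate (adjacent v)

  degree : Fin n → ℕ
  degree v = ∣ neighbours v ∣

  weightedAdjacency : Matrix n
  weightedAdjacency u v = if adjacent u v then weight u v else 0ℝ

  weightedDegree : Fin n → ℝ
  weightedDegree u = ∑[ v < n ] weightedAdjacency u v

  laplacian : Matrix n
  laplacian u v = (if does (u Finₚ.≟ v) then weightedDegree u else 0ℝ) - weightedAdjacency u v

open WeightedGraph public using (degree; laplacian)

complete : ∀ n → WeightedGraph n
complete n = record
  { adjacent   = λ u v → not (does (u Finₚ.≟ v))
  ; adj-sym    = adj-sym
  ; adj-irrefl = adj-irrefl
  ; weight     = λ _ _ → 1ℝ
  ; weight-sym = λ _ _ _ → ≃-refl
  ; weight-pos = λ _ _ _ → fromℕ-pos (ℕₚ.≤-refl {1})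
  }
  where
  adj-sym : ∀ (u v : Fin n) → not (does (u Finₚ.≟ v)) ≡ not (does (v Finₚ.≟ u))
  adj-sym u v with u Finₚ.≟ v | v Finₚ.≟ u
  ... | yes _   | yes _   = refl
  ... | yes u≡v | no v≢u  = contradiction (sym u≡v) v≢u
  ... | no u≢v  | yes v≡u = contradiction (sym v≡u) u≢v
  ... | no _    | no _    = refl
  adj-irrefl : ∀ (v : Fin n) → not (does (v Finₚ.≟ v)) ≡ false
  adj-irrefl v with v Finₚ.≟ v
  ... | yes _  = refl
  ... | no v≢v = contradiction refl v≢v

infix 4 _[_]-approximates_

_[_]-approximates_ : ∀ {n} → WeightedGraph n → ℝ → WeightedGraph n → Set
_[_]-approximates_ {n} H κ G = ∀ (x : Vector n) →
  x ᵀ laplacian G · x ≤ x ᵀ laplacian H · x × x ᵀ laplacian H · x ≤ κ * (x ᵀ laplacian G · x)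

-- The Laplacian is the symmetric matrix whose quadratic form is the sum of
-- w_{u,v} (x_u - x_v)² over the edges; each edge is counted once, with u < v.
module _ {n : ℕ} (H : WeightedGraph n) where
  open WeightedGraph H using (adjacent; weight; weightedAdjacency; weightedDegree; adj-sym; weight-sym)

  weightedAdjacency-sym : ∀ u v → weightedAdjacency u v ≃ weightedAdjacency v u
  weightedAdjacency-sym u v with adjacent u v in uv | adjacent v u in vu
  ... | true  | true  = weight-sym u v uv
  ... | false | false = ≃-refl
  ... | true  | false = contradiction (trans (sym uv) (trans (adj-sym u v) vu)) λ ()
  ... | false | true  = contradiction (trans (sym uv) (trans (adj-sym u v) vu)) λ ()

  laplacian-symmetric : ∀ u v → laplacian H u v ≃ laplacian H v u
  laplacian-symmetric u v with u Finₚ.≟ v | v Finₚ.≟ u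
  ... | yes refl | yes _   = ≃-refl
  ... | yes u≡v  | no v≢u  = contradiction (sym u≡v) v≢u
  ... | no u≢v   | yes v≡u = contradiction (sym v≡u) u≢v
  ... | no _     | no _    = +-cong ≃-refl (-‿cong (weightedAdjacency-sym u v))

  edgeTerm : Vector n → Fin n → Fin n → ℝ
  edgeTerm x u v = if does (u Finₚ.<? v) ∧ adjacent u v
    then weight u v * ((x u - x v) * (x u - x v)) else 0ℝ

  laplacian-quadraticForm : ∀ x → x ᵀ laplacian H · x ≃ ∑[ u < n ] ∑[ v < n ] edgeTerm x u v
  laplacian-quadraticForm x = begin
    ∑[ u < n ] ∑[ v < n ] (x u * laplacian H u v * x v)
      ≈⟨ ∑-cong row ⟩
    ∑[ u < n ] ∑[ v < n ] f u v
      ≈⟨ ∑-cong (λ u → ∑-cong (split u)) ⟩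
    ∑[ u < n ] ∑[ v < n ] (up u v + lo u v)
      ≈⟨ ∑∑-+ up lo ⟩
    (∑[ u < n ] ∑[ v < n ] up u v) + (∑[ u < n ] ∑[ v < n ] lo u v)
      ≈⟨ +-cong ≃-refl (∑-comm lo) ⟩
    (∑[ u < n ] ∑[ v < n ] up u v) + (∑[ u < n ] ∑[ v < n ] lo v u)
      ≈⟨ ∑∑-+ up (λ u v → lo v u) ⟨
    ∑[ u < n ] ∑[ v < n ] (up u v + lo v u)
      ≈⟨ ∑-cong (λ u → ∑-cong (λ v → combine u v)) ⟩
    ∑[ u < n ] ∑[ v < n ] edgeTerm x u v ∎
    where
    open import Relation.Binary.Reasoning.Setoid setoid
    open +-*-Solver using (solve; _:+_; _:-_; _:*_; :-_; _:=_; con)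
    A = weightedAdjacency
    f up lo : Fin n → Fin n → ℝ
    f u v = x u * A u v * x u - x u * A u v * x v
    up u v = if does (u Finₚ.<? v) then f u v else 0ℝ
    lo u v = if does (v Finₚ.<? u) then f u v else 0ℝ

    ∑∑-+ : (g h : Fin n → Fin n → ℝ) → ∑[ u < n ] ∑[ v < n ] (g u v + h u v) ≃
           (∑[ u < n ] ∑[ v < n ] g u v) + (∑[ u < n ] ∑[ v < n ] h u v)
    ∑∑-+ g h = ≃-trans (∑-cong λ u → ∑-distrib-+ (g u) (h u))
      (∑-distrib-+ (λ u → ∑[ v < n ] g u v) (λ u → ∑[ v < n ] h u v))

    diag : Fin n → Fin n → ℝ
    diag u v = if does (u Finₚ.≟ v) then x u * weightedDegree u * x v else 0ℝ

    expand : ∀ u v → x u * laplacian H u v * x v ≃ diag u v + (- (x u * A u v * x v))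
    expand u v with u Finₚ.≟ v
    ... | yes _ = ≃-pointwise λ k → solve 4 (λ p d a q → p :* (d :- a) :* q := p :* d :* q :+ (:- (p :* a :* q)))
                    refl (seq (x u) k) (seq (weightedDegree u) k) (seq (A u v) k) (seq (x v) k)
    ... | no _  = ≃-pointwise λ k → solve 3 (λ p a q → p :* (con 0ℚ :- a) :* q := con 0ℚ :+ (:- (p :* a :* q)))
                    refl (seq (x u) k) (seq (A u v) k) (seq (x v) k)

    row : ∀ u → ∑[ v < n ] (x u * laplacian H u v * x v) ≃ ∑[ v < n ] f u v
    row u = begin
      ∑[ v < n ] (x u * laplacian H u v * x v)
        ≈⟨ ∑-cong (expand u) ⟩
      ∑[ v < n ] (diag u v + (- (x u * A u v * x v)))
        ≈⟨ ∑-distrib-+ (diag u) (λ v → - (x u * A u v * x v)) ⟩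
      (∑[ v < n ] diag u v) + (∑[ v < n ] (- (x u * A u v * x v)))
        ≈⟨ +-cong (∑-δ u (λ v → x u * weightedDegree u * x v)) ≃-refl ⟩
      x u * weightedDegree u * x u + (∑[ v < n ] (- (x u * A u v * x v)))
        ≈⟨ +-cong (*-cong (*-distribˡ-sum (x u) (A u)) ≃-refl) ≃-refl ⟩
      (∑[ v < n ] (x u * A u v)) * x u + (∑[ v < n ] (- (x u * A u v * x v)))
        ≈⟨ +-cong (*-distribʳ-sum (x u) (λ v → x u * A u v)) ≃-refl ⟩
      (∑[ v < n ] (x u * A u v * x u)) + (∑[ v < n ] (- (x u * A u v * x v)))
        ≈⟨ ∑-distrib-+ (λ v → x u * A u v * x u) (λ v → - (x u * A u v * x v)) ⟨
      ∑[ v < n ] f u v ∎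

    f-diagonal : ∀ u → f u u ≃ 0ℝ
    f-diagonal u = ≃-pointwise λ k → ℚₚ.+-inverseʳ (seq (x u * A u u * x u) k)

    split : ∀ u v → f u v ≃ up u v + lo u v
    split u v with Finₚ.<-cmp u v
    ... | tri< u<v _ v≮u rewrite dec-true (u Finₚ.<? v) u<v | dec-false (v Finₚ.<? u) v≮u =
      ≃-sym (+ℝ-identityʳ (f u v))
    ... | tri> u≮v _ v<u rewrite dec-false (u Finₚ.<? v) u≮v | dec-true (v Finₚ.<? u) v<u =
      ≃-sym (+ℝ-identityˡ (f u v))
    ... | tri≈ u≮u refl _ rewrite dec-false (u Finₚ.<? u) u≮u =
      ≃-trans (f-diagonal u) (≃-sym (+ℝ-identityˡ 0ℝ))

    combine : ∀ u v → up u v + lo v u ≃ edgeTerm x u v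
    combine u v with does (u Finₚ.<? v)
    ... | false = +ℝ-identityˡ 0ℝ
    ... | true  = ≃-trans
      (+-cong ≃-refl (+-cong (*-cong (*-cong ≃-refl vu) ≃-refl) (-‿cong (*-cong (*-cong ≃-refl vu) ≃-refl))))
      edge
      where
      vu = weightedAdjacency-sym v u
      edge : f u v + (x v * A u v * x v - x v * A u v * x u) ≃
             (if adjacent u v then weight u v * ((x u - x v) * (x u - x v)) else 0ℝ)
      edge with adjacent u v
      ... | true  = ≃-pointwise λ k → solve 3 (λ p w q →
              (p :* w :* p :- p :* w :* q) :+ (q :* w :* q :- q :* w :* p) := w :* ((p :- q) :* (p :- q)))
              refl (seq (x u) k) (seq (weight u v) k) (seq (x v) k)
      ... | false = ≃-pointwise λ k → solve 2 (λ p q →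
              (p :* con 0ℚ :* p :- p :* con 0ℚ :* q) :+ (q :* con 0ℚ :* q :- q :* con 0ℚ :* p) := con 0ℚ)
              refl (seq (x u) k) (seq (x v) k)

{-# OPTIONS --safe #-}

-- Let Q_H and Q_G be the Laplacian quadratic forms, e the indicator of v, b the
-- indicator of its neighbours in H, s = √d, and W the weighted degree of v in H.
-- Comparing the forms at s e + b (lower bound) and at s e - b (upper bound) and
-- subtracting cancels everything in H except the cross term:
--   4 s W ≤ κ Q_G(s e - b) - Q_G(s e + b).
-- The forms at e give W ≥ n - 1 and κ ≥ 1, and for the complete graph
-- Q_G(s e - b) = 2nd - d (s - 1)² and Q_G(s e - b) - Q_G(s e + b) = 4sd, so
--   4 s (n - 1) ≤ 2nd (κ - 1) + 4sd.
-- Dividing by 2nd and using 1/s ≤ s gives the bound with C = 4.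

module Submission where

open import Defs
open ℚ-Facts using (p≤∣p∣; half>0; half+half; inv; inv>0; *>0; scale)
open import Algebra.Bundles using (CommutativeRing)
import Algebra.Properties.Semiring.Sum as SemiringSum
open import Data.Bool.Base using (Bool; true; false; if_then_else_; not)
open import Data.Fin.Base as Fin using (Fin)
import Data.Fin.Properties as Finₚ
open import Data.Fin.Subset using (∣_∣)
open import Data.Integer.Base as ℤ using (+_)
import Data.Integer.Properties as ℤₚ
open import Data.Nat.Base as ℕ using (ℕ; zero; suc; s≤s)
import Data.Nat.Properties as ℕₚ
open import Data.Nat.Properties using (<⇒≤)
open import Data.Product using (Σ-syntax; _,_; proj₁; proj₂)
open import Data.Rational.Base as ℚ using (ℚ; 0ℚ; 1ℚ; ½)
import Data.Rational.Properties as ℚₚ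
open import Data.Rational.Solver using (module +-*-Solver)
import Data.Rational.Unnormalised.Base as ℚᵘ
import Data.Rational.Unnormalised.Properties as ℚᵘₚ
open import Data.Sum.Base using (inj₁; inj₂)
open import Data.Vec.Base using (tabulate)
open import Relation.Binary.PropositionalEquality using (_≡_; refl; sym; trans; cong; subst; subst₂)
open import Relation.Nullary.Decidable using (does; dec-true; yes; no)

open CommutativeRing ℝ-commutativeRing using (setoid; semiring; +-identityˡ; zeroʳ; *-assoc; *-identityʳ)
open SemiringSum semiring
  using (sum-syntax; ∑-distrib-+; ∑-comm; *-distribˡ-sum; *-distribʳ-sum)
open +-*-Solver using (solve; _:+_; _:-_; _:*_; :-_; _:=_; con)

-- Order on the reals

0≤-ℚ+ : ∀ {p q} → 0ℚ ℚ.≤ p → 0ℚ ℚ.≤ q → 0ℚ ℚ.≤ p ℚ.+ q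
0≤-ℚ+ = ℚₚ.+-mono-≤

0≤-ℚ* : ∀ {p q} → 0ℚ ℚ.≤ p → 0ℚ ℚ.≤ q → 0ℚ ℚ.≤ p ℚ.* q
0≤-ℚ* {p} {q} 0≤p 0≤q = subst (ℚ._≤ p ℚ.* q) (ℚₚ.*-zeroˡ q)
  (ℚₚ.*-monoʳ-≤-nonNeg q {{ℚ.nonNegative 0≤q}} 0≤p)

0≤-ℚ- : ∀ {p q} → p ℚ.≤ q → 0ℚ ℚ.≤ q ℚ.- p
0≤-ℚ- {p} {q} p≤q = subst (ℚ._≤ q ℚ.- p) (ℚₚ.+-inverseʳ p) (ℚₚ.+-monoˡ-≤ (ℚ.- p) p≤q)

0≤-ℚsquare : ∀ p → 0ℚ ℚ.≤ p ℚ.* p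
0≤-ℚsquare p with ℚₚ.≤-total 0ℚ p
... | inj₁ 0≤p = 0≤-ℚ* 0≤p 0≤p
... | inj₂ p≤0 = subst (0ℚ ℚ.≤_)
  (solve 1 (λ p → (con 0ℚ :- p) :* (con 0ℚ :- p) := p :* p) refl p)
  (0≤-ℚ* (0≤-ℚ- p≤0) (0≤-ℚ- p≤0))

-- The junk value of `recip` is 0, so the sign holds at every index and `0≤-1/` can be proved
-- termwise.
0≤-recip : ∀ q → 0ℚ ℚ.≤ recip q
0≤-recip q with 0ℚ ℚₚ.<? q
... | yes q>0 = ℚₚ.<⇒≤ (inv>0 q q>0)
... | no  _   = ℚₚ.≤-refl

-- A nonnegative real may have slightly negative terms, so `p` and `q` are only known to be at least
-- `-δ`. The sign of `q` decides how to write `p q + B δ` as a sum of two products of nonnegative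
-- factors.
product-lower-bound : ∀ {p q B δ} → 0ℚ ℚ.≤ B → 0ℚ ℚ.≤ δ → p ℚ.≤ B → q ℚ.≤ B →
  0ℚ ℚ.≤ p ℚ.+ δ → 0ℚ ℚ.≤ q ℚ.+ δ → 0ℚ ℚ.≤ p ℚ.* q ℚ.+ B ℚ.* δ
product-lower-bound {p} {q} {B} {δ} 0≤B 0≤δ p≤B q≤B 0≤p+δ 0≤q+δ with ℚₚ.≤-total 0ℚ q
... | inj₁ 0≤q = subst (0ℚ ℚ.≤_)
  (solve 4 (λ p q B δ → (p :+ δ) :* q :+ δ :* (B :- q) := p :* q :+ B :* δ) refl p q B δ)
  (0≤-ℚ+ (0≤-ℚ* 0≤p+δ 0≤q) (0≤-ℚ* 0≤δ (0≤-ℚ- q≤B)))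
... | inj₂ q≤0 = subst (0ℚ ℚ.≤_)
  (solve 4 (λ p q B δ → (B :- p) :* (con 0ℚ :- q) :+ B :* (q :+ δ) := p :* q :+ B :* δ) refl p q B δ)
  (0≤-ℚ+ (0≤-ℚ* (0≤-ℚ- p≤B) (0≤-ℚ- q≤0)) (0≤-ℚ* 0≤B 0≤q+δ))

0≤-pointwise : ∀ {x} → (∀ k → 0ℚ ℚ.≤ seq x k) → 0ℝ ≤ x
0≤-pointwise 0≤x = mk≤ λ ε ε>0 → always λ k → 0≤-ℚ+ (0≤x k) (ℚₚ.<⇒≤ ε>0)

-- Lets later inequalities be proved as nonnegativity of a single expression: known nonnegative
-- terms are added and a ring identity rewrites the sum.
0≤-resp-≃ : ∀ {x y} → x ≃ y → 0ℝ ≤ x → 0ℝ ≤ y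
0≤-resp-≃ {x} {y} x≃y 0≤x = mk≤ λ ε ε>0 → eventually-zip
  (λ k c b → subst (0ℚ ℚ.≤_)
    (trans (solve 3 (λ a b h → (a :+ h) :+ (h :- (a :- b)) := b :+ (h :+ h)) refl
             (seq x k) (seq y k) (½ ℚ.* ε))
           (cong (seq y k ℚ.+_) (half+half ε)))
    (0≤-ℚ+ b (0≤-ℚ- (ℚₚ.≤-trans (p≤∣p∣ (seq x k ℚ.- seq y k)) (ℚₚ.<⇒≤ c)))))
  (close x≃y _ (half>0 ε>0)) (below 0≤x _ (half>0 ε>0))

0≤-+ : ∀ {x y} → 0ℝ ≤ x → 0ℝ ≤ y → 0ℝ ≤ x + y
0≤-+ {x} {y} 0≤x 0≤y = mk≤ λ ε ε>0 → eventually-zip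
  (λ k a b → subst (0ℚ ℚ.≤_)
    (trans (solve 3 (λ a b h → (a :+ h) :+ (b :+ h) := (a :+ b) :+ (h :+ h)) refl
             (seq x k) (seq y k) (½ ℚ.* ε))
           (cong (seq x k ℚ.+ seq y k ℚ.+_) (half+half ε)))
    (0≤-ℚ+ a b))
  (below 0≤x _ (half>0 ε>0)) (below 0≤y _ (half>0 ε>0))

0≤-* : ∀ {x y} → 0ℝ ≤ x → 0ℝ ≤ y → 0ℝ ≤ x * y
0≤-* {x} {y} 0≤x 0≤y = mk≤ λ ε ε>0 →
  let B , B>0 , b = common-bound x y
      -- With this `δ` the slack `B δ` is exactly `ε`.
      δ = inv B B>0 ℚ.* ε
      δ>0 = *>0 (inv>0 B B>0) ε>0
  in eventually-zip
       (λ k (∣x∣≤B , ∣y∣≤B) (0≤x+δ , 0≤y+δ) →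
         subst (λ t → 0ℚ ℚ.≤ seq x k ℚ.* seq y k ℚ.+ t) (scale B B>0 ε)
           (product-lower-bound (ℚₚ.<⇒≤ B>0) (ℚₚ.<⇒≤ δ>0)
             (ℚₚ.≤-trans (p≤∣p∣ (seq x k)) ∣x∣≤B) (ℚₚ.≤-trans (p≤∣p∣ (seq y k)) ∣y∣≤B) 0≤x+δ 0≤y+δ))
       b (eventually-zip (λ _ → _,_) (below 0≤x δ δ>0) (below 0≤y δ δ>0))

≤⇒0≤- : ∀ {x y} → x ≤ y → 0ℝ ≤ y - x
≤⇒0≤- {x} {y} x≤y = mk≤ λ ε ε>0 → eventually-map
  (λ k le → subst (0ℚ ℚ.≤_)
    (solve 3 (λ x y ε → (y :+ ε) :- x := (y :- x) :+ ε) refl (seq x k) (seq y k) ε) (0≤-ℚ- le))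
  (below x≤y ε ε>0)

0≤-⇒≤ : ∀ {x y} → 0ℝ ≤ y - x → x ≤ y
0≤-⇒≤ {x} {y} 0≤y-x = mk≤ λ ε ε>0 → eventually-map
  (λ k le → subst₂ ℚ._≤_ (ℚₚ.+-identityʳ (seq x k))
    (solve 3 (λ x y ε → x :+ ((y :- x) :+ ε) := y :+ ε) refl (seq x k) (seq y k) ε)
    (ℚₚ.+-monoʳ-≤ (seq x k) le))
  (below 0≤y-x ε ε>0)

0≤-square : ∀ x → 0ℝ ≤ x * x
0≤-square x = 0≤-pointwise λ k → 0≤-ℚsquare (seq x k)

0≤-fromℕ : ∀ n → 0ℝ ≤ fromℕ n
0≤-fromℕ n = 0≤-pointwise λ _ → ℚₚ.nonNegative⁻¹ _ {{ℚₚ.normalize-nonNeg n 1}}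

0≤-1/ : ∀ x (x>0 : 0ℝ < x) → 0ℝ ≤ 1/ x x>0
0≤-1/ x x>0 = 0≤-pointwise λ k → 0≤-recip (seq x k)

0≤-cancelʳ-* : ∀ {x y} → 0ℝ < y → 0ℝ ≤ x * y → 0ℝ ≤ x
0≤-cancelʳ-* {x} {y} y>0 0≤xy = 0≤-resp-≃ eq (0≤-* 0≤xy (0≤-1/ y y>0))
  where
  eq : x * y * 1/ y y>0 ≃ x
  eq = ≃-trans (*-assoc x y (1/ y y>0))
    (≃-trans (*-cong ≃-refl (1/-inverseʳ y y>0)) (*-identityʳ x))

fromℕ-suc : ∀ n → fromℕ (suc n) ≃ 1ℝ + fromℕ n
-- Reduction to lowest terms is stuck on a variable `n`, so the fractions are compared by
-- cross-multiplication.
fromℕ-suc n = ≃-pointwise λ _ → ℚₚ.toℚᵘ-injective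
  (ℚᵘₚ.≃-trans (frac-toℚᵘ (suc n) 0) (ℚᵘₚ.≃-sym
    (ℚᵘₚ.≃-trans (ℚₚ.toℚᵘ-homo-+ 1ℚ (frac n 0))
    (ℚᵘₚ.≃-trans (ℚᵘₚ.+-congʳ (ℚ.toℚᵘ 1ℚ) (frac-toℚᵘ n 0))
      (ℚᵘ.*≡* (cong (ℤ._* (+ 1))
        (cong (λ i → (+ 1) ℤ.+ i) (ℤₚ.*-identityʳ (+ n)))))))))

1≤fromℕ : ∀ {n} → 1 ℕ.≤ n → 0ℝ ≤ fromℕ n - 1ℝ
1≤fromℕ {n} 1≤n = 0≤-pointwise λ _ →
  0≤-ℚ- (frac-≤ {1} {0} {n} {0} (ℕₚ.*-monoˡ-≤ 1 1≤n))

-- Sums and bilinear forms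

indicator : Bool → ℝ
indicator c = if c then 1ℝ else 0ℝ

∑-one : ∀ n → ∑[ i < n ] 1ℝ ≃ fromℕ n
∑-one zero = ≃-refl
∑-one (suc n) = ≃-trans (+-cong ≃-refl (∑-one n)) (≃-sym (fromℕ-suc n))

-- Turns a degree, defined as the size of a `Subset`, into a real sum that can occur inside a
-- quadratic form.
∑-indicator : ∀ {n} (f : Fin n → Bool) → ∑[ i < n ] indicator (f i) ≃ fromℕ ∣ tabulate f ∣
∑-indicator {zero} f = ≃-refl
∑-indicator {suc n} f with f Fin.zero
... | true  = ≃-trans (+-cong ≃-refl (∑-indicator (λ i → f (Fin.suc i))))
  (≃-sym (fromℕ-suc ∣ tabulate (λ i → f (Fin.suc i)) ∣))
... | false = ≃-trans (+-identityˡ _) (∑-indicator (λ i → f (Fin.suc i)))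

-- The standard basis vector at `v`; the test is oriented as in `∑-δ`.
δ : ∀ {n} → Fin n → Vector n
δ v u = indicator (does (v Finₚ.≟ u))

∑∑-+ : ∀ {n} (g h : Matrix n) → ∑[ u < n ] ∑[ w < n ] (g u w + h u w) ≃
       (∑[ u < n ] ∑[ w < n ] g u w) + (∑[ u < n ] ∑[ w < n ] h u w)
∑∑-+ {n} g h = ≃-trans (∑-cong λ u → ∑-distrib-+ (g u) (h u))
  (∑-distrib-+ (λ u → ∑[ w < n ] g u w) (λ u → ∑[ w < n ] h u w))

∑∑-* : ∀ {n} (a : ℝ) (g : Matrix n) → ∑[ u < n ] ∑[ w < n ] (a * g u w) ≃ a * (∑[ u < n ] ∑[ w < n ] g u w)
∑∑-* {n} a g = ≃-sym (≃-trans (*-distribˡ-sum a (λ u → ∑[ w < n ] g u w))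
  (∑-cong λ u → *-distribˡ-sum a (g u)))

∑-*δ : ∀ {n} (v : Fin n) (f : Vector n) → ∑[ w < n ] (f w * δ v w) ≃ f v
∑-*δ {n} v f = ≃-trans (∑-cong term) (∑-δ v f)
  where
  term : ∀ w → f w * δ v w ≃ (if does (v Finₚ.≟ w) then f w else 0ℝ)
  term w with does (v Finₚ.≟ w)
  ... | true  = *-identityʳ (f w)
  ... | false = zeroʳ (f w)

module _ {n : ℕ} (M : Matrix n) where

  bilinear : Vector n → Vector n → ℝ
  bilinear x y = ∑[ u < n ] ∑[ w < n ] (x u * M u w * y w)

  -- Bilinear expansion, checked entry by entry and index by index. The two cross terms stay apart
  -- here; symmetry of the Laplacian merges them in `quadratic-testVector`.
  quadratic-combination : ∀ a t (x y : Vector n) →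
    (λ u → a * x u + t * y u) ᵀ M · (λ u → a * x u + t * y u) ≃
      (a * a * bilinear x x + a * t * bilinear x y) + (a * t * bilinear y x + t * t * bilinear y y)
  quadratic-combination a t x y = begin
    _ ≈⟨ ∑-cong (λ u → ∑-cong λ w → ≃-pointwise λ k →
           solve 7 (λ a t p q m r s → (a :* p :+ t :* q) :* m :* (a :* r :+ t :* s) :=
               (a :* a :* (p :* m :* r) :+ a :* t :* (p :* m :* s)) :+
               (a :* t :* (q :* m :* r) :+ t :* t :* (q :* m :* s)))
             refl (seq a k) (seq t k) (seq (x u) k) (seq (y u) k) (seq (M u w) k)
             (seq (x w) k) (seq (y w) k)) ⟩
    _ ≈⟨ ∑∑-+ (λ u w → a * a * (x u * M u w * x w) + a * t * (x u * M u w * y w))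
              (λ u w → a * t * (y u * M u w * x w) + t * t * (y u * M u w * y w)) ⟩
    _ ≈⟨ +-cong
           (∑∑-+ (λ u w → a * a * (x u * M u w * x w)) (λ u w → a * t * (x u * M u w * y w)))
           (∑∑-+ (λ u w → a * t * (y u * M u w * x w)) (λ u w → t * t * (y u * M u w * y w))) ⟩
    _ ≈⟨ +-cong
           (+-cong (∑∑-* (a * a) (λ u w → x u * M u w * x w)) (∑∑-* (a * t) (λ u w → x u * M u w * y w)))
           (+-cong (∑∑-* (a * t) (λ u w → y u * M u w * x w)) (∑∑-* (t * t) (λ u w → y u * M u w * y w))) ⟩
    _ ∎
    where open import Relation.Binary.Reasoning.Setoid setoid

  -- Exchanging the sums puts the index of `δ v` innermost, where `∑-δ` picks out row `v`.
  bilinear-δˡ : ∀ v (y : Vector n) → bilinear (δ v) y ≃ ∑[ w < n ] (M v w * y w)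
  bilinear-δˡ v y = ≃-trans (∑-comm (λ u w → δ v u * M u w * y w))
    (∑-cong λ w → ≃-trans (∑-cong (λ u → term u w)) (∑-δ v (λ u → M u w * y w)))
    where
    term : ∀ u w → δ v u * M u w * y w ≃ (if does (v Finₚ.≟ u) then M u w * y w else 0ℝ)
    term u w with does (v Finₚ.≟ u)
    ... | true  = ≃-pointwise λ k →
      solve 2 (λ m y → con 1ℚ :* m :* y := m :* y) refl (seq (M u w) k) (seq (y w) k)
    ... | false = ≃-pointwise λ k →
      solve 2 (λ m y → con 0ℚ :* m :* y := con 0ℚ) refl (seq (M u w) k) (seq (y w) k)

  bilinear-comm : (∀ u w → M u w ≃ M w u) → ∀ x y → bilinear x y ≃ bilinear y x
  bilinear-comm M-sym x y = ≃-trans (∑-comm (λ u w → x u * M u w * y w))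
    (∑-cong λ w → ∑-cong λ u → ≃-trans (*-cong (*-cong ≃-refl (M-sym u w)) ≃-refl)
      (≃-pointwise λ k → solve 3 (λ p m q → p :* m :* q := q :* m :* p) refl
        (seq (x u) k) (seq (M w u) k) (seq (y w) k)))

  quadratic-δ : ∀ v → δ v ᵀ M · δ v ≃ M v v
  quadratic-δ v = ≃-trans (bilinear-δˡ v (δ v)) (∑-*δ v (M v))

-- Laplacians

-1ℝ : ℝ
-1ℝ = - 1ℝ

laplacian-diagonal : ∀ {n} (H : WeightedGraph n) v →
  laplacian H v v ≃ WeightedGraph.weightedDegree H v
laplacian-diagonal H v rewrite dec-true (v Finₚ.≟ v) refl | WeightedGraph.adj-irrefl H v =
  ≃-pointwise λ k → ℚₚ.+-identityʳ (seq (WeightedGraph.weightedDegree H v) k)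

complete-weightedDegree : ∀ {n} (u : Fin n) →
  WeightedGraph.weightedDegree (complete n) u ≃ fromℕ n - 1ℝ
complete-weightedDegree {n} u = begin
  ∑[ w < n ] indicator (not (does (u Finₚ.≟ w)))        ≈⟨ ∑-cong term ⟩
  ∑[ w < n ] (1ℝ + -1ℝ * δ u w)                         ≈⟨ ∑-distrib-+ (λ _ → 1ℝ) (λ w → -1ℝ * δ u w) ⟩
  (∑[ w < n ] 1ℝ) + (∑[ w < n ] (-1ℝ * δ u w))          ≈⟨ +-cong (∑-one n) (∑-*δ u (λ _ → -1ℝ)) ⟩
  fromℕ n - 1ℝ                                          ∎
  where
  open import Relation.Binary.Reasoning.Setoid setoid
  term : ∀ w → indicator (not (does (u Finₚ.≟ w))) ≃ 1ℝ + -1ℝ * δ u w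
  term w with does (u Finₚ.≟ w)
  ... | true  = ≃-pointwise λ _ → refl
  ... | false = ≃-pointwise λ _ → refl

-- This is `n I - J` with `J` the all-ones matrix: the diagonal degree `n - 1` splits as `n` minus
-- the 1 of `J`.
complete-laplacian : ∀ {n} (u w : Fin n) → laplacian (complete n) u w ≃ fromℕ n * δ u w - 1ℝ
complete-laplacian {n} u w with u Finₚ.≟ w
... | yes _ = ≃-trans (+-cong (complete-weightedDegree u) ≃-refl) (≃-pointwise λ k →
  solve 1 (λ n → (n :- con 1ℚ) :- con 0ℚ := n :* con 1ℚ :- con 1ℚ) refl (seq (fromℕ n) k))
... | no _  = ≃-pointwise λ k →
  solve 1 (λ n → con 0ℚ :- con 1ℚ := n :* con 0ℚ :- con 1ℚ) refl (seq (fromℕ n) k)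

-- In `n I - J` the identity contributes the sum of squares and `J` the square of the sum.
complete-quadratic : ∀ {n} (x : Vector n) → x ᵀ laplacian (complete n) · x ≃
  fromℕ n * (∑[ u < n ] (x u * x u)) - (∑[ u < n ] x u) * (∑[ u < n ] x u)
complete-quadratic {n} x = begin
  ∑[ u < n ] ∑[ w < n ] (x u * laplacian (complete n) u w * x w)
    ≈⟨ ∑-cong (λ u → ∑-cong λ w → ≃-trans
         (*-cong (*-cong ≃-refl (complete-laplacian u w)) ≃-refl)
         (≃-pointwise λ k → solve 4 (λ p n d q → p :* (n :* d :- con 1ℚ) :* q :=
             n :* (p :* q :* d) :+ (:- con 1ℚ) :* (p :* q)) refl
           (seq (x u) k) (seq (fromℕ n) k) (seq (δ u w) k) (seq (x w) k))) ⟩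
  ∑[ u < n ] ∑[ w < n ] (fromℕ n * (x u * x w * δ u w) + -1ℝ * (x u * x w))
    ≈⟨ ∑∑-+ (λ u w → fromℕ n * (x u * x w * δ u w)) (λ u w → -1ℝ * (x u * x w)) ⟩
  _
    ≈⟨ +-cong (∑∑-* (fromℕ n) (λ u w → x u * x w * δ u w)) (∑∑-* -1ℝ (λ u w → x u * x w)) ⟩
  _
    ≈⟨ +-cong (*-cong ≃-refl (∑-cong λ u → ∑-*δ u (λ w → x u * x w)))
              (*-cong ≃-refl (∑-cong λ u → ≃-sym (*-distribˡ-sum (x u) x))) ⟩
  _
    ≈⟨ +-cong ≃-refl (*-cong ≃-refl (≃-sym (*-distribʳ-sum (∑[ u < n ] x u) x))) ⟩
  _
    ≈⟨ ≃-pointwise (λ k → solve 3 (λ n a b → n :* a :+ (:- con 1ℚ) :* (b :* b) := n :* a :- b :* b) refl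
         (seq (fromℕ n) k) (seq (∑[ u < n ] (x u * x u)) k) (seq (∑[ u < n ] x u) k)) ⟩
  _ ∎
  where open import Relation.Binary.Reasoning.Setoid setoid

-- Test vectors on a vertex and its neighbourhood

module _ {n : ℕ} (H : WeightedGraph n) (v : Fin n) where
  open WeightedGraph H using (adjacent; adj-irrefl; weightedAdjacency; weightedDegree)

  neighbourVector : Vector n
  neighbourVector u = indicator (adjacent v u)

  testVector : ℝ → ℝ → Vector n
  testVector a t u = a * δ v u + t * neighbourVector u

  -- `K` is separate from `H` because the vector built from the neighbours in `H` is tested both in
  -- `H` and in the complete graph. Replacing `t = 1` by `t = -1` changes only the sign of the
  -- middle term.
  quadratic-testVector : ∀ (K : WeightedGraph n) a t →
    testVector a t ᵀ laplacian K · testVector a t ≃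
      a * a * WeightedGraph.weightedDegree K v
      + (a * t + a * t) * (∑[ w < n ] (laplacian K v w * neighbourVector w))
      + t * t * (neighbourVector ᵀ laplacian K · neighbourVector)
  quadratic-testVector K a t = ≃-trans
    (quadratic-combination L a t (δ v) neighbourVector)
    (≃-trans
      (+-cong
        (+-cong (*-cong ≃-refl (≃-trans (quadratic-δ L v) (laplacian-diagonal K v)))
                (*-cong ≃-refl (bilinear-δˡ L v neighbourVector)))
        (+-cong (*-cong ≃-refl (≃-trans (bilinear-comm L (laplacian-symmetric K) neighbourVector (δ v))
                                        (bilinear-δˡ L v neighbourVector)))
                ≃-refl))
      (≃-pointwise λ k → solve 5 (λ a t w c b →
          (a :* a :* w :+ a :* t :* c) :+ (a :* t :* c :+ t :* t :* b) :=
          a :* a :* w :+ (a :* t :+ a :* t) :* c :+ t :* t :* b) refl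
        (seq a k) (seq t k) (seq (WeightedGraph.weightedDegree K v) k)
        (seq (∑[ w < n ] (L v w * neighbourVector w)) k)
        (seq (neighbourVector ᵀ L · neighbourVector) k)))
    where L = laplacian K

  -- All edges at `v` end in its neighbourhood, so the cross term captures the whole weighted
  -- degree; the entry at `v` itself is killed by the absence of loops.
  laplacian-neighbours : ∑[ w < n ] (laplacian H v w * neighbourVector w) ≃ -1ℝ * weightedDegree v
  laplacian-neighbours = ≃-trans (∑-cong term) (≃-sym (*-distribˡ-sum -1ℝ (weightedAdjacency v)))
    where
    term : ∀ w → laplacian H v w * neighbourVector w ≃ -1ℝ * weightedAdjacency v w
    term w with v Finₚ.≟ w
    ... | yes refl rewrite adj-irrefl v = ≃-pointwise λ k →
      solve 1 (λ d → (d :- con 0ℚ) :* con 0ℚ := (:- con 1ℚ) :* con 0ℚ) refl (seq (weightedDegree v) k)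
    ... | no _ with adjacent v w
    ...   | true  = ≃-pointwise λ k →
      solve 1 (λ a → (con 0ℚ :- a) :* con 1ℚ := (:- con 1ℚ) :* a) refl (seq (WeightedGraph.weight H v w) k)
    ...   | false = ≃-pointwise λ k → refl

  -- Each neighbour differs from `v`, so it meets an entry -1 of the complete Laplacian.
  complete-neighbours : ∑[ w < n ] (laplacian (complete n) v w * neighbourVector w) ≃ -1ℝ * fromℕ (degree H v)
  complete-neighbours = ≃-trans (∑-cong term) (≃-trans (≃-sym (*-distribˡ-sum -1ℝ neighbourVector))
    (*-cong ≃-refl (∑-indicator (adjacent v))))
    where
    term : ∀ w → laplacian (complete n) v w * neighbourVector w ≃ -1ℝ * neighbourVector w
    term w with v Finₚ.≟ w
    ... | yes refl rewrite adj-irrefl v = ≃-pointwise λ k →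
      solve 1 (λ d → (d :- con 0ℚ) :* con 0ℚ := (:- con 1ℚ) :* con 0ℚ) refl
        (seq (WeightedGraph.weightedDegree (complete n) v) k)
    ... | no _ = ≃-pointwise λ k →
      solve 1 (λ b → (con 0ℚ :- con 1ℚ) :* b := (:- con 1ℚ) :* b) refl (seq (neighbourVector w) k)

  -- An indicator is idempotent, so in `complete-quadratic` both the sum and the sum of squares are
  -- the degree.
  complete-neighbourhood : neighbourVector ᵀ laplacian (complete n) · neighbourVector ≃
    fromℕ n * fromℕ (degree H v) - fromℕ (degree H v) * fromℕ (degree H v)
  complete-neighbourhood = ≃-trans (complete-quadratic neighbourVector)
    (+-cong (*-cong ≃-refl (≃-trans (∑-cong idem) count)) (-‿cong (*-cong count count)))
    where
    count : ∑[ u < n ] neighbourVector u ≃ fromℕ (degree H v)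
    count = ∑-indicator (adjacent v)
    idem : ∀ u → neighbourVector u * neighbourVector u ≃ neighbourVector u
    idem u with adjacent v u
    ... | true  = ≃-pointwise λ _ → refl
    ... | false = ≃-pointwise λ _ → refl

  graph-testVector : ∀ a t → testVector a t ᵀ laplacian H · testVector a t ≃
    a * a * weightedDegree v + (a * t + a * t) * (-1ℝ * weightedDegree v)
    + t * t * (neighbourVector ᵀ laplacian H · neighbourVector)
  graph-testVector a t = ≃-trans (quadratic-testVector H a t)
    (+-cong (+-cong ≃-refl (*-cong ≃-refl laplacian-neighbours)) ≃-refl)

  -- `D` stands for the degree so that `s * s` can be substituted, which makes the later identities
  -- polynomial in `s`.
  complete-testVector : ∀ {D} → fromℕ (degree H v) ≃ D → ∀ a t →
    testVector a t ᵀ laplacian (complete n) · testVector a t ≃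
    a * a * (fromℕ n - 1ℝ) + (a * t + a * t) * (-1ℝ * D) + t * t * (fromℕ n * D - D * D)
  complete-testVector deg a t = ≃-trans (quadratic-testVector (complete n) a t)
    (+-cong (+-cong (*-cong ≃-refl (complete-weightedDegree v))
                    (*-cong ≃-refl (≃-trans complete-neighbours (*-cong ≃-refl deg))))
            (*-cong ≃-refl (≃-trans complete-neighbourhood
              (+-cong (*-cong ≃-refl deg) (-‿cong (*-cong deg deg))))))

  private
    N = fromℕ n
    W = weightedDegree v

  -- Inequalities forced by the approximation

  module _ {κ : ℝ} (approx : H [ κ ]-approximates complete n) where

    private
      quadratic-e : ∀ K → δ v ᵀ laplacian K · δ v ≃ WeightedGraph.weightedDegree K v
      quadratic-e K = ≃-trans (quadratic-δ (laplacian K) v) (laplacian-diagonal K v)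

      quadratic-e-complete : δ v ᵀ laplacian (complete n) · δ v ≃ N - 1ℝ
      quadratic-e-complete = ≃-trans (quadratic-e (complete n)) (complete-weightedDegree v)

    weightedDegree-lower : 0ℝ ≤ W - (N - 1ℝ)
    weightedDegree-lower = 0≤-resp-≃ (+-cong (quadratic-e H) (-‿cong quadratic-e-complete))
      (≤⇒0≤- (proj₁ (approx (δ v))))

    weightedDegree-upper : 0ℝ ≤ κ * (N - 1ℝ) - W
    weightedDegree-upper = 0≤-resp-≃
      (+-cong (*-cong ≃-refl quadratic-e-complete) (-‿cong (quadratic-e H)))
      (≤⇒0≤- (proj₂ (approx (δ v))))

    approximation≥1 : 1 ℕ.< n → 0ℝ ≤ κ - 1ℝ
    -- Adding `n - 1 ≤ W` and `W ≤ κ (n - 1)` leaves a multiple of `n - 1`, which is `m` and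
    -- positive.
    approximation≥1 (s≤s {n = m} 1≤m) = 0≤-cancelʳ-* (fromℕ-pos 1≤m)
      (0≤-resp-≃ (≃-trans
          (≃-pointwise λ k → solve 3 (λ κ n w →
              (w :- (n :- con 1ℚ)) :+ (κ :* (n :- con 1ℚ) :- w) := (κ :- con 1ℚ) :* (n :- con 1ℚ))
            refl (seq κ k) (seq N k) (seq W k))
          (*-cong ≃-refl (≃-trans (+-cong (fromℕ-suc m) (≃-refl {x = -1ℝ}))
            (≃-pointwise λ k → solve 1 (λ m → (con 1ℚ :+ m) :- con 1ℚ := m) refl (seq (fromℕ m) k)))))
        (0≤-+ weightedDegree-lower weightedDegree-upper))

    scaled-bound : ∀ {s} → 1 ℕ.< n → 0ℝ ≤ s → fromℕ (degree H v) ≃ s * s →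
      0ℝ ≤ fromℕ 2 * N * (s * s) * (κ - 1ℝ) + fromℕ 4 * (s * s * s) - fromℕ 4 * s * (N - 1ℝ)
    scaled-bound {s} 1<n 0≤s deg = 0≤-resp-≃
      -- `β` is the form of `H` at the neighbour indicator. Nothing is known about it, but it enters
      -- `QH one` and `QH -one` equally and cancels.
      (≃-pointwise λ k → solve 5 (λ κ w n s β →
          let one = con 1ℚ
              -one = :- con 1ℚ
              four = con (+ 4 ℚ./ 1)
              QH t = s :* s :* w :+ (s :* t :+ s :* t) :* (-one :* w) :+ t :* t :* β
              QG t = s :* s :* (n :- one) :+ (s :* t :+ s :* t) :* (-one :* (s :* s))
                     :+ t :* t :* (n :* (s :* s) :- s :* s :* (s :* s))
          in ((QH one :- QG one) :+ (κ :* QG -one :- QH -one))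
               :+ (four :* s :* (w :- (n :- one)) :+ (κ :- one) :* (s :* (s :- one) :* (s :* (s :- one))))
             := con (+ 2 ℚ./ 1) :* n :* (s :* s) :* (κ :- one) :+ four :* (s :* s :* s) :- four :* s :* (n :- one))
        refl (seq κ k) (seq W k) (seq N k) (seq s k)
        (seq (neighbourVector ᵀ laplacian H · neighbourVector) k))
      (0≤-+
        (0≤-+
          (0≤-resp-≃ (+-cong (graph-testVector s 1ℝ) (-‿cong (complete-testVector deg s 1ℝ)))
            (≤⇒0≤- (proj₁ (approx (testVector s 1ℝ)))))
          (0≤-resp-≃ (+-cong (*-cong ≃-refl (complete-testVector deg s -1ℝ)) (-‿cong (graph-testVector s -1ℝ)))
            (≤⇒0≤- (proj₂ (approx (testVector s -1ℝ))))))
        (0≤-+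
          -- Replaces `W` in the cross term by its lower bound `n - 1`.
          (0≤-* (0≤-* (0≤-fromℕ 4) 0≤s) weightedDegree-lower)
          -- Discards `- s² (s - 1)²` from the complete form at `s e - b`; its coefficient is
          -- `κ - 1`, hence the need for `κ ≥ 1`.
          (0≤-* (approximation≥1 1<n) (0≤-square (s * (s - 1ℝ))))))

-- Division by the scale factor

-- With `ν = 1/N` and `r = 1/s`, dividing by `2 N s²` gives `κ ≥ 1 + 2r - 2sν - 2rν`, and `r ≤ s`
-- turns the last two terms into `- 4sν`. The inverse laws hold only up to `≃`, so a termwise
-- identity cannot use them and carries correction terms instead.
bound-from-scaled : ∀ {κ N s ν r} → N * ν ≃ 1ℝ → s * r ≃ 1ℝ →
  0ℝ ≤ ν → 0ℝ ≤ r → 0ℝ ≤ s * s - 1ℝ →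
  0ℝ ≤ fromℕ 2 * N * (s * s) * (κ - 1ℝ) + fromℕ 4 * (s * s * s) - fromℕ 4 * s * (N - 1ℝ) →
  1ℝ + fromℕ 2 * r - fromℕ 4 * (s * ν) ≤ κ
bound-from-scaled {κ} {N} {s} {ν} {r} Nν≃1 sr≃1 0≤ν 0≤r 1≤s² 0≤P = 0≤-⇒≤ (0≤-resp-≃
  (≃-pointwise λ k → solve 5 (λ κ n s ν r →
      let one = con 1ℚ
          two = con (+ 2 ℚ./ 1)
          four = con (+ 4 ℚ./ 1)
          P = two :* n :* (s :* s) :* (κ :- one) :+ four :* (s :* s :* s) :- four :* s :* (n :- one)
          X = κ :- one :- two :* r
          Y = ((κ :- one) :* (n :* ν) :+ two :* s :* ν) :* (one :+ s :* r)
              :+ two :* ν :* r :- two :* (n :* ν) :* r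
          Z = two :* ν :* s
      in con ½ :* (ν :* (r :* r)) :* P :+ two :* ν :* (r :* (s :* s :- one))
           :+ ((one :- n :* ν) :* X :+ (one :- s :* r) :* (Y :+ Z))
         := κ :- (one :+ two :* r :- four :* (s :* ν)))
    refl (seq κ k) (seq N k) (seq s k) (seq ν k) (seq r k))
  (0≤-+
    (0≤-+ (0≤-* (0≤-* (0≤-pointwise {constant ½} λ _ → ℚₚ.nonNegative⁻¹ ½) (0≤-* 0≤ν (0≤-* 0≤r 0≤r))) 0≤P)
          -- This product is `2ν (s - r)`: it trades the `2νr` left over from `N - 1` for `2νs`.
          (0≤-* (0≤-* (0≤-fromℕ 2) 0≤ν) (0≤-* 0≤r 1≤s²)))
    (0≤-resp-≃ (≃-sym (+-cong (vanish Nν≃1 X) (vanish sr≃1 (Y + Z)))) (0≤-pointwise λ _ → ℚₚ.≤-refl))))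
  where
  -- Multiplying the hypothesis by ½ ν r² gives the conclusion only modulo
  -- N ν ≃ 1 and s r ≃ 1. X is the cofactor of 1 - N ν in the error; Y and Z
  -- are those of 1 - s r, Z coming from r ≤ s.
  X Y Z : ℝ
  X = κ - 1ℝ - fromℕ 2 * r
  Y = ((κ - 1ℝ) * (N * ν) + fromℕ 2 * s * ν) * (1ℝ + s * r) + fromℕ 2 * ν * r - fromℕ 2 * (N * ν) * r
  Z = fromℕ 2 * ν * s
  vanish : ∀ {a} → a ≃ 1ℝ → ∀ x → (1ℝ - a) * x ≃ 0ℝ
  vanish a≃1 x = ≃-trans (*-cong (+-cong ≃-refl (-‿cong a≃1)) ≃-refl)
    (≃-pointwise λ k → ℚₚ.*-zeroˡ (seq x k))

proposition4p2 : Σ[ C ∈ ℝ ] (∀ (n d : ℕ) (1<n : 1 ℕ.< n) (1≤d : 1 ℕ.≤ d)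
    (H : WeightedGraph n) (v : Fin n) → degree H v ≡ d →
    (κ : ℝ) → H [ κ ]-approximates complete n →
    1ℝ + fromℕ 2 / √ d ⟨ √-pos 1≤d ⟩ - C * (√ d / fromℕ n ⟨ fromℕ-pos (<⇒≤ 1<n) ⟩) ≤ κ)
proposition4p2 = fromℕ 4 , λ n d 1<n 1≤d H v deg κ approx →
  let 0<n = fromℕ-pos (<⇒≤ 1<n)
      0<s = √-pos 1≤d
      d≃s² = ≃-sym (√-square d)
  in bound-from-scaled (1/-inverseʳ (fromℕ n) 0<n) (1/-inverseʳ (√ d) 0<s)
       (0≤-1/ (fromℕ n) 0<n) (0≤-1/ (√ d) 0<s)
       -- The hypothesis `1 ≤ d` becomes `s² ≥ 1`, the source of `1/s ≤ s`.
       (0≤-resp-≃ (+-cong d≃s² ≃-refl) (1≤fromℕ 1≤d))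
       (scaled-bound H v approx 1<n (√-nonNegative d)
         (subst (λ m → fromℕ m ≃ √ d * √ d) (sym deg) d≃s²))
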